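{- Let $p$ be a prime, let $m\ge 0$ be an integer, and let $f:\mathbb{Z}_p\to\mathbb{Z}_p$ be an analytic function of level $m$. Let $I'=\{\beta=(\beta_0,\dots,\beta_{m-1})\in\mathbb{Z}^m : 0\le\beta_0,\dots,\beta_{m-1}\le p-1\}$. Then there exists a unique restricted power series $F\in\mathbb{Z}_p[[x_0,x_1,\dots,x_m]]$ such that (1) $F(x_0,\dots,x_m)=\sum_{n\ge 0}\sum_{\beta\in I'} a_{\beta,n}\,x_0^{\beta_0}x_1^{\beta_1}\cdots x_{m-1}^{\beta_{m-1}}x_m^n$ for some $a_{\beta,n}\in\mathbb{Z}_p$ (i.e. every monomial of $F$ has degree at most $p-1$ in each of $x_0,\dots,x_{m-1}$), and (2) $f(a)=F(a,\delta a,\dots,\delta^m a)$ for all $a\in\mathbb{Z}_p$.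
   Context: $\mathbb{Z}_p$ denotes the ring of $p$-adic integers with the $p$-adic norm $|\cdot|_p$, $|p|_p=p^{ -1}$. The Fermat quotient operator is $\delta:\mathbb{Z}_p\to\mathbb{Z}_p$, $\delta a=(a-a^p)/p$, and $\delta^i$ denotes its $i$-th iterate. A power series $F=\sum_{\alpha} a_\alpha x^\alpha\in\mathbb{Z}_p[[x_0,\dots,x_k]]$ is called restricted if $a_\alpha\to 0$ $p$-adically as $|\alpha|=\alpha_0+\dots+\alpha_k\to\infty$. A function $f:\mathbb{Z}_p\to\mathbb{Z}_p$ is analytic of level $m$ if for every $a\in\mathbb{Z}_p$ there is a restricted power series $F_a\in\mathbb{Z}_p[[x]]$ (one variable) such that $f(a+p^m u)=F_a(u)$ for all $u\in\mathbb{Z}_p$. For $m=0$, $I'$ consists of the single empty tuple and condition (1) says $F=\sum_n a_n x_0^n$. -}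

module Defs where

open import Algebra.Bundles using (CommutativeRing)
import Algebra.Properties.CommutativeSemiring.Binomial as Binomial
import Algebra.Properties.Semiring.Divisibility as Divisibility
import Algebra.Properties.Semiring.Exp as Exp
import Algebra.Properties.Semiring.Mult as Mult
import Algebra.Properties.Semiring.Sum as Sum
open import Data.Fin.Base as Fin using (Fin; toℕ; fromℕ)
open import Data.Fin.Properties using (toℕ<n; toℕ-inject₁; toℕ-fromℕ)
open import Data.Integer.Base as ℤ using (ℤ; +_; -[1+_])
open import Data.Integer.Divisibility.Signed as ℤ∣ using (divides; quotient)
import Data.Integer.Properties as ℤ
open import Data.Integer.Tactic.RingSolver using (solve-∀)
open import Data.List.Base as List using (List; []; _∷_)
open import Data.Nat.Base as ℕ using (ℕ; zero; suc; _≤_; _<_; _∸_; _!; s≤s; z≤n)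
open import Data.Nat.Combinatorics using (_C_; nCn≡1; nCk≡n!/k![n-k]!; k![n∸k]!∣n!)
import Data.Nat.Divisibility as ℕ∣
import Data.Nat.DivMod as ℕ/
open import Data.Nat.Primality using (Prime; euclidsLemma; prime⇒nonZero; prime⇒nonTrivial)
import Data.Nat.Properties as ℕ
open import Data.Product using (∃; _×_; _,_)
open import Data.Sum.Base using (inj₁; inj₂)
open import Data.Vec.Base as Vec using (Vec; []; _∷_)
open import Function.Base using (_∘_)
open import Function.Bundles using (Func)
open import Level using (0ℓ)
open import Relation.Binary.PropositionalEquality using (_≡_; refl; sym; trans; cong; cong₂; subst; subst₂; module ≡-Reasoning)
open import Relation.Nullary.Negation using (¬_; contradiction)

-- Fermat's little theorem, so that δ is an exact division

module Fermat (p : ℕ) (p-prime : Prime p) where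

  private instance
    p≢0 : ℕ.NonZero p
    p≢0 = prime⇒nonZero p-prime

  p∣k!⇒p≤k : ∀ k → p ℕ∣.∣ k ! → p ≤ k
  p∣k!⇒p≤k zero    p∣1 = contradiction (ℕ∣.∣1⇒≡1 p∣1)
    (ℕ.nonTrivial⇒≢1 {{prime⇒nonTrivial p-prime}})
  p∣k!⇒p≤k (suc k) p∣k! with euclidsLemma (suc k) (k !) p-prime p∣k!
  ... | inj₁ p∣1+k = ℕ∣.∣⇒≤ p∣1+k
  ... | inj₂ p∣k!′ = ℕ.m≤n⇒m≤1+n (p∣k!⇒p≤k k p∣k!′)

  p∣pCk : ∀ k → 0 < k → k < p → p ℕ∣.∣ p C k
  p∣pCk k 0<k k<p with euclidsLemma d (p C k) p-prime p∣d*pCk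
    where
    d = k ! ℕ.* (p ∸ k) !
    k≤p = ℕ.<⇒≤ k<p
    instance
      d≢0 : ℕ.NonZero d
      d≢0 = ℕ.m*n≢0 (k !) ((p ∸ k) !) {{k ℕ.!≢0}} {{(p ∸ k) ℕ.!≢0}}
    d*pCk≡p! : d ℕ.* (p C k) ≡ p !
    d*pCk≡p! = trans (cong (d ℕ.*_) (nCk≡n!/k![n-k]! k≤p))
                     (ℕ/.m*[n/m]≡n (k![n∸k]!∣n! k≤p))
    n∣n! : ∀ n .{{_ : ℕ.NonZero n}} → n ℕ∣.∣ n !
    n∣n! (suc n) = ℕ∣.m∣m*n (n !)
    p∣d*pCk : p ℕ∣.∣ d ℕ.* (p C k)
    p∣d*pCk = subst (p ℕ∣.∣_) (sym d*pCk≡p!) (n∣n! p)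
  ... | inj₂ p∣C = p∣C
  ... | inj₁ p∣d with euclidsLemma (k !) ((p ∸ k) !) p-prime p∣d
  ...   | inj₁ p∣k! = contradiction (p∣k!⇒p≤k k p∣k!) (ℕ.<⇒≱ k<p)
  ...   | inj₂ p∣[p-k]! = contradiction (p∣k!⇒p≤k (p ∸ k) p∣[p-k]!)
            (ℕ.<⇒≱ (ℕ.∸-monoʳ-< 0<k (ℕ.<⇒≤ k<p)))

  private
    ℤ-semiring = CommutativeRing.semiring ℤ.+-*-commutativeRing
    open Sum ℤ-semiring using (sum; sum-init-last)
    open Exp ℤ-semiring using () renaming (_^_ to _^ᴱ_)
    open Mult ℤ-semiring using () renaming (_×_ to _×ᴹ_)
    open Binomial (CommutativeRing.commutativeSemiring ℤ.+-*-commutativeRing)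

    ^ᴱ≡^ : ∀ x n → x ^ᴱ n ≡ x ℤ.^ n
    ^ᴱ≡^ x zero    = refl
    ^ᴱ≡^ x (suc n) = cong (x ℤ.*_) (^ᴱ≡^ x n)

    ×ᴹ≡* : ∀ n x → n ×ᴹ x ≡ + n ℤ.* x
    ×ᴹ≡* zero    x = sym (ℤ.*-zeroˡ x)
    ×ᴹ≡* (suc n) x = trans (cong (λ y → x ℤ.+ y) (×ᴹ≡* n x)) (sym (ℤ.suc-* (+ n) x))

    1^ : ∀ n → ℤ.1ℤ ^ᴱ n ≡ ℤ.1ℤ
    1^ zero    = refl
    1^ (suc n) = trans (ℤ.*-identityˡ _) (1^ n)

    ∣-sum : ∀ {n} k (t : Fin n → ℤ) → (∀ i → k ℤ∣.∣ t i) → k ℤ∣.∣ sum t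
    ∣-sum {zero}  k t k∣t = divides ℤ.0ℤ (sym (ℤ.*-zeroˡ k))
    ∣-sum {suc n} k t k∣t =
      ℤ∣.∣m∣n⇒∣m+n (k∣t Fin.zero) (∣-sum k (t ∘ Fin.suc) (k∣t ∘ Fin.suc))

    freshman-suc : ∀ q → p ≡ suc q → ∀ x →
      + p ℤ∣.∣ (x ℤ.+ ℤ.1ℤ) ℤ.^ p ℤ.- (x ℤ.^ p ℤ.+ ℤ.1ℤ)
    freshman-suc q refl x = subst (+ p ℤ∣.∣_) (sym eq) p∣mid
      where
      t : Fin (suc p) → ℤ
      t = binomialTerm x ℤ.1ℤ p
      mid : Fin q → ℤ
      mid i = t (Fin.suc (Fin.inject₁ i))
      b : Fin q → ℤ
      b i = binomial x ℤ.1ℤ p (Fin.suc (Fin.inject₁ i))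
      p∣mid : + p ℤ∣.∣ sum mid
      p∣mid = ∣-sum (+ p) mid λ i →
        let j = toℕ (Fin.inject₁ i)
            j<q = subst (_< q) (sym (toℕ-inject₁ i)) (toℕ<n i)
        in subst (+ p ℤ∣.∣_) (sym (×ᴹ≡* (p C suc j) (b i)))
             (ℤ∣.∣m⇒∣m*n {m = + (p C suc j)} (b i) (ℤ∣.∣ᵤ⇒∣ (p∣pCk (suc j) (s≤s z≤n) (s≤s j<q))))
      t-first : t Fin.zero ≡ ℤ.1ℤ
      t-first = trans (×ᴹ≡* 1 _) (trans (ℤ.*-identityˡ _)
        (trans (ℤ.*-identityˡ _) (1^ p)))
      t-last : t (fromℕ p) ≡ x ℤ.^ p
      t-last = begin
        (p C toℕ (fromℕ p)) ×ᴹ (x ^ᴱ toℕ (fromℕ p) ℤ.* ℤ.1ℤ ^ᴱ (p ∸ toℕ (fromℕ p)))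
          ≡⟨ cong (λ k → (p C k) ×ᴹ (x ^ᴱ k ℤ.* ℤ.1ℤ ^ᴱ (p ∸ k))) (toℕ-fromℕ p) ⟩
        (p C p) ×ᴹ (x ^ᴱ p ℤ.* ℤ.1ℤ ^ᴱ (p ∸ p))
          ≡⟨ cong₂ _×ᴹ_ (nCn≡1 p) (cong₂ ℤ._*_ (^ᴱ≡^ x p) (1^ (p ∸ p))) ⟩
        1 ×ᴹ (x ℤ.^ p ℤ.* ℤ.1ℤ)
          ≡⟨ trans (ℤ.+-identityʳ _) (ℤ.*-identityʳ _) ⟩
        x ℤ.^ p ∎
        where open ≡-Reasoning
      rearrange : ∀ a b → (ℤ.1ℤ ℤ.+ (a ℤ.+ b)) ℤ.- (b ℤ.+ ℤ.1ℤ) ≡ a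
      rearrange = solve-∀
      eq : (x ℤ.+ ℤ.1ℤ) ℤ.^ p ℤ.- (x ℤ.^ p ℤ.+ ℤ.1ℤ) ≡ sum mid
      eq = begin
        (x ℤ.+ ℤ.1ℤ) ℤ.^ p ℤ.- (x ℤ.^ p ℤ.+ ℤ.1ℤ)
          ≡⟨ cong (ℤ._- (x ℤ.^ p ℤ.+ ℤ.1ℤ))
               (trans (sym (^ᴱ≡^ (x ℤ.+ ℤ.1ℤ) p)) (theorem p x ℤ.1ℤ)) ⟩
        (t Fin.zero ℤ.+ sum (t ∘ Fin.suc)) ℤ.- (x ℤ.^ p ℤ.+ ℤ.1ℤ)
          ≡⟨ cong (ℤ._- (x ℤ.^ p ℤ.+ ℤ.1ℤ)) (cong₂ ℤ._+_ t-first
               (trans (sum-init-last (t ∘ Fin.suc)) (cong (λ y → sum mid ℤ.+ y) t-last))) ⟩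
        (ℤ.1ℤ ℤ.+ (sum mid ℤ.+ x ℤ.^ p)) ℤ.- (x ℤ.^ p ℤ.+ ℤ.1ℤ)
          ≡⟨ rearrange (sum mid) (x ℤ.^ p) ⟩
        sum mid ∎
        where open ≡-Reasoning

  freshman : ∀ x → + p ℤ∣.∣ (x ℤ.+ ℤ.1ℤ) ℤ.^ p ℤ.- (x ℤ.^ p ℤ.+ ℤ.1ℤ)
  freshman = freshman-suc (ℕ.pred p) (sym (ℕ.suc-pred p))

  private
    Good : ℤ → Set
    Good x = + p ℤ∣.∣ x ℤ.- x ℤ.^ p

    good-suc : ∀ x → Good x → Good (x ℤ.+ ℤ.1ℤ)
    good-suc x g = subst (+ p ℤ∣.∣_) (identity x (x ℤ.^ p) _)
      (ℤ∣.∣m∣n⇒∣m-n g (freshman x))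
      where
      identity : ∀ x y z → (x ℤ.- y) ℤ.- (z ℤ.- (y ℤ.+ ℤ.1ℤ)) ≡ (x ℤ.+ ℤ.1ℤ) ℤ.- z
      identity = solve-∀

    good-pred : ∀ x → Good (x ℤ.+ ℤ.1ℤ) → Good x
    good-pred x g = subst (+ p ℤ∣.∣_) (identity x (x ℤ.^ p) _)
      (ℤ∣.∣m∣n⇒∣m+n g (freshman x))
      where
      identity : ∀ x y z → ((x ℤ.+ ℤ.1ℤ) ℤ.- z) ℤ.+ (z ℤ.- (y ℤ.+ ℤ.1ℤ)) ≡ x ℤ.- y
      identity = solve-∀

    good-0 : Good ℤ.0ℤ
    good-0 = subst (λ n → + p ℤ∣.∣ ℤ.0ℤ ℤ.- ℤ.0ℤ ℤ.^ n) (ℕ.suc-pred p)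
      (divides ℤ.0ℤ (sym (ℤ.*-zeroˡ (+ p))))

    good-pos : ∀ n → Good (+ n)
    good-pos zero    = good-0
    good-pos (suc n) = subst Good (ℤ.+-comm (+ n) ℤ.1ℤ) (good-suc (+ n) (good-pos n))

    good-neg : ∀ n → Good -[1+ n ]
    good-neg zero    = good-pred -[1+ 0 ] good-0
    good-neg (suc n) = good-pred -[1+ suc n ] (good-neg n)

  fermat : ∀ x → + p ℤ∣.∣ x ℤ.- x ℤ.^ p
  fermat (+ n)    = good-pos n
  fermat -[1+ n ] = good-neg n

module Cong where
  ∣-zero : ∀ k {a} → a ≡ ℤ.0ℤ → k ℤ∣.∣ a
  ∣-zero k refl = divides ℤ.0ℤ (sym (ℤ.*-zeroˡ k))

  ∣-refl : ∀ {k a b} → a ≡ b → k ℤ∣.∣ a ℤ.- b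
  ∣-refl {k} {a} refl = ∣-zero k (ℤ.+-inverseʳ a)

  ∣-sym : ∀ {k} a b → k ℤ∣.∣ a ℤ.- b → k ℤ∣.∣ b ℤ.- a
  ∣-sym a b d = subst (_ ℤ∣.∣_) (eq a b) (ℤ∣.∣m⇒∣-m d)
    where
    eq : ∀ a b → ℤ.- (a ℤ.- b) ≡ b ℤ.- a
    eq = solve-∀

  ∣-trans : ∀ {k} a b c → k ℤ∣.∣ a ℤ.- b → k ℤ∣.∣ b ℤ.- c → k ℤ∣.∣ a ℤ.- c
  ∣-trans a b c d e = subst (_ ℤ∣.∣_) (eq a b c) (ℤ∣.∣m∣n⇒∣m+n d e)
    where
    eq : ∀ a b c → (a ℤ.- b) ℤ.+ (b ℤ.- c) ≡ a ℤ.- c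
    eq = solve-∀

  ∣-+ : ∀ {k} a b c d → k ℤ∣.∣ a ℤ.- b → k ℤ∣.∣ c ℤ.- d →
        k ℤ∣.∣ (a ℤ.+ c) ℤ.- (b ℤ.+ d)
  ∣-+ a b c d e f = subst (_ ℤ∣.∣_) (eq a b c d) (ℤ∣.∣m∣n⇒∣m+n e f)
    where
    eq : ∀ a b c d → (a ℤ.- b) ℤ.+ (c ℤ.- d) ≡ (a ℤ.+ c) ℤ.- (b ℤ.+ d)
    eq = solve-∀

  ∣-neg : ∀ {k} a b → k ℤ∣.∣ a ℤ.- b → k ℤ∣.∣ (ℤ.- a) ℤ.- (ℤ.- b)
  ∣-neg a b d = subst (_ ℤ∣.∣_) (eq a b) (ℤ∣.∣m⇒∣-m d)
    where
    eq : ∀ a b → ℤ.- (a ℤ.- b) ≡ (ℤ.- a) ℤ.- (ℤ.- b)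
    eq = solve-∀

  ∣-* : ∀ {k} a b c d → k ℤ∣.∣ a ℤ.- b → k ℤ∣.∣ c ℤ.- d →
        k ℤ∣.∣ (a ℤ.* c) ℤ.- (b ℤ.* d)
  ∣-* a b c d e f = subst (_ ℤ∣.∣_) (eq a b c d)
    (ℤ∣.∣m∣n⇒∣m+n (ℤ∣.∣m⇒∣m*n c e) (ℤ∣.∣n⇒∣m*n b f))
    where
    eq : ∀ a b c d → (a ℤ.- b) ℤ.* c ℤ.+ b ℤ.* (c ℤ.- d) ≡ (a ℤ.* c) ℤ.- (b ℤ.* d)
    eq = solve-∀

  ∣-^ : ∀ {k} a b n → k ℤ∣.∣ a ℤ.- b → k ℤ∣.∣ a ℤ.^ n ℤ.- b ℤ.^ n
  ∣-^ a b zero    d = ∣-refl {a = ℤ.1ℤ} refl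
  ∣-^ a b (suc n) d = ∣-* a b (a ℤ.^ n) (b ℤ.^ n) d (∣-^ a b n d)

module PAdic (p : ℕ) (p-prime : Prime p) where

  open Cong
  open Fermat p p-prime using (fermat)

  -- ℤₚ = lim ℤ/pⁿ, an element being given by integer representatives
  -- of its residues mod pⁿ.
  record ℤₚ : Set where
    constructor mkℤₚ
    field
      res      : ℕ → ℤ
      coherent : ∀ n → (+ p) ℤ.^ n ℤ∣.∣ res (suc n) ℤ.- res n

  open ℤₚ public

  infix 4 _≈_

  record _≈_ (x y : ℤₚ) : Set where
    constructor mk≈
    field
      res-≈ : ∀ n → (+ p) ℤ.^ n ℤ∣.∣ res x n ℤ.- res y n

  open _≈_ public

  fromℤ : ℤ → ℤₚ
  fromℤ z = mkℤₚ (λ _ → z) (λ _ → ∣-refl {a = z} refl)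

  private
    _+ₚ_ : ℤₚ → ℤₚ → ℤₚ
    x +ₚ y = mkℤₚ (λ n → res x n ℤ.+ res y n)
      (λ n → ∣-+ (res x (suc n)) (res x n) (res y (suc n)) (res y n)
                 (coherent x n) (coherent y n))

    _*ₚ_ : ℤₚ → ℤₚ → ℤₚ
    x *ₚ y = mkℤₚ (λ n → res x n ℤ.* res y n)
      (λ n → ∣-* (res x (suc n)) (res x n) (res y (suc n)) (res y n)
                 (coherent x n) (coherent y n))

    -ₚ_ : ℤₚ → ℤₚ
    -ₚ x = mkℤₚ (λ n → ℤ.- res x n)
      (λ n → ∣-neg (res x (suc n)) (res x n) (coherent x n))

    pointwise : ∀ {x y} → (∀ n → res x n ≡ res y n) → x ≈ y
    pointwise eq = mk≈ λ n → ∣-refl (eq n)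

  ℤₚ-commutativeRing : CommutativeRing 0ℓ 0ℓ
  ℤₚ-commutativeRing = record
    { Carrier = ℤₚ
    ; _≈_ = _≈_
    ; _+_ = _+ₚ_
    ; _*_ = _*ₚ_
    ; -_  = -ₚ_
    ; 0#  = fromℤ ℤ.0ℤ
    ; 1#  = fromℤ ℤ.1ℤ
    ; isCommutativeRing = record
      { isRing = record
        { +-isAbelianGroup = record
          { isGroup = record
            { isMonoid = record
              { isSemigroup = record
                { isMagma = record
                  { isEquivalence = record
                    { refl  = pointwise (λ _ → refl)
                    ; sym   = λ {x} {y} e → mk≈ λ n →
                        ∣-sym (res x n) (res y n) (res-≈ e n)
                    ; trans = λ {x} {y} {z} e f → mk≈ λ n →
                        ∣-trans (res x n) (res y n) (res z n) (res-≈ e n) (res-≈ f n)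
                    }
                  ; ∙-cong = λ {x} {y} {u} {v} e f → mk≈ λ n →
                      ∣-+ (res x n) (res y n) (res u n) (res v n) (res-≈ e n) (res-≈ f n)
                  }
                ; assoc = λ x y z → pointwise λ n → ℤ.+-assoc (res x n) (res y n) (res z n)
                }
              ; identity = (λ x → pointwise λ n → ℤ.+-identityˡ (res x n))
                         , (λ x → pointwise λ n → ℤ.+-identityʳ (res x n))
              }
            ; inverse = (λ x → pointwise λ n → ℤ.+-inverseˡ (res x n))
                      , (λ x → pointwise λ n → ℤ.+-inverseʳ (res x n))
            ; ⁻¹-cong = λ {x} {y} e → mk≈ λ n → ∣-neg (res x n) (res y n) (res-≈ e n)
            }
          ; comm = λ x y → pointwise λ n → ℤ.+-comm (res x n) (res y n)
          }
        ; *-cong = λ {x} {y} {u} {v} e f → mk≈ λ n →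
            ∣-* (res x n) (res y n) (res u n) (res v n) (res-≈ e n) (res-≈ f n)
        ; *-assoc = λ x y z → pointwise λ n → ℤ.*-assoc (res x n) (res y n) (res z n)
        ; *-identity = (λ x → pointwise λ n → ℤ.*-identityˡ (res x n))
                     , (λ x → pointwise λ n → ℤ.*-identityʳ (res x n))
        ; distrib = (λ x y z → pointwise λ n → ℤ.*-distribˡ-+ (res x n) (res y n) (res z n))
                  , (λ x y z → pointwise λ n → ℤ.*-distribʳ-+ (res x n) (res y n) (res z n))
        }
      ; *-comm = λ x y → pointwise λ n → ℤ.*-comm (res x n) (res y n)
      }
    }

  open CommutativeRing ℤₚ-commutativeRing public
    using (_+_; _*_; _-_; -_; 0#; 1#; semiring) renaming (setoid to ℤₚ-setoid)
  open Exp semiring public using (_^_)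
  open Divisibility semiring public using (_∣_)

  pₚ : ℤₚ
  pₚ = fromℤ (+ p)

  -- The bound |x|ₚ ≤ p⁻ᴺ, i.e. x ∈ pᴺℤₚ.
  ∣_∣ₚ≤p^-_ : ℤₚ → ℕ → Set
  ∣ x ∣ₚ≤p^- N = pₚ ^ N ∣ x

  infix 4 _⟶_

  _⟶_ : (ℕ → ℤₚ) → ℤₚ → Set
  s ⟶ y = ∀ N → ∃ λ M → ∀ n → M ≤ n → ∣ s n - y ∣ₚ≤p^- N

  private
    instance
      +p≢0 : ℤ.NonZero (+ p)
      +p≢0 = prime⇒nonZero p-prime

    -- Exact division by p loses one digit of precision.
    quotient-∣ : ∀ n a b → (+ p) ℤ.^ suc n ℤ∣.∣ a ℤ.- b →
      (+ p) ℤ.^ n ℤ∣.∣ quotient (fermat a) ℤ.- quotient (fermat b)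
    quotient-∣ n a b d = ℤ∣.*-cancelʳ-∣ (+ p)
      (subst₂ ℤ∣._∣_ (ℤ.*-comm (+ p) ((+ p) ℤ.^ n)) eq
        (∣-+ a b (ℤ.- (a ℤ.^ p)) (ℤ.- (b ℤ.^ p)) d
          (∣-neg (a ℤ.^ p) (b ℤ.^ p) (∣-^ a b p d))))
      where
      factor : ∀ q r s → q ℤ.* s ℤ.- r ℤ.* s ≡ (q ℤ.- r) ℤ.* s
      factor = solve-∀
      eq : (a ℤ.- a ℤ.^ p) ℤ.- (b ℤ.- b ℤ.^ p)
         ≡ (quotient (fermat a) ℤ.- quotient (fermat b)) ℤ.* + p
      eq = trans (cong₂ ℤ._-_ (ℤ∣._∣_.equality (fermat a)) (ℤ∣._∣_.equality (fermat b)))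
                 (factor (quotient (fermat a)) (quotient (fermat b)) (+ p))

  -- δ a = (a - aᵖ)/p; computing it mod pⁿ needs a mod pⁿ⁺¹.
  δ : ℤₚ → ℤₚ
  δ a = mkℤₚ (λ n → quotient (fermat (res a (suc n))))
    (λ n → quotient-∣ n (res a (suc (suc n))) (res a (suc n)) (coherent a (suc n)))

  δ-cong : ∀ {a b} → a ≈ b → δ a ≈ δ b
  δ-cong {a} {b} e = mk≈ λ n → quotient-∣ n (res a (suc n)) (res b (suc n)) (res-≈ e (suc n))

  res-^ : ∀ a k n → res (a ^ k) n ≡ res a n ℤ.^ k
  res-^ a zero    n = refl
  res-^ a (suc k) n = cong (res a n ℤ.*_) (res-^ a k n)

  δ-spec : ∀ a → pₚ * δ a ≈ a - a ^ p
  δ-spec a = mk≈ λ n → subst₂ (λ u v → (+ p) ℤ.^ n ℤ∣.∣ u ℤ.- (res a n ℤ.- v))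
    (trans (ℤ∣._∣_.equality (fermat (res a (suc n)))) (ℤ.*-comm _ (+ p)))
    (sym (res-^ a p n))
    (∣-+ (res a (suc n)) (res a n) (ℤ.- (res a (suc n) ℤ.^ p)) (ℤ.- (res a n ℤ.^ p))
      (coherent a n)
      (∣-neg (res a (suc n) ℤ.^ p) (res a n ℤ.^ p)
        (∣-^ (res a (suc n)) (res a n) p (coherent a n))))

  -- ℤₚ[[x₀,…,xₖ₋₁]]: the coefficient of each monomial x^α.
  PowerSeries : ℕ → Set
  PowerSeries k = Vec ℕ k → ℤₚ

  infix 4 _≋_

  _≋_ : ∀ {k} → PowerSeries k → PowerSeries k → Set
  F ≋ G = ∀ α → F α ≈ G α

  Restricted : ∀ {k} → PowerSeries k → Set
  Restricted F = ∀ N → ∃ λ M → ∀ α → M ≤ Vec.sum α → ∣ F α ∣ₚ≤p^- N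

  monomial : ∀ {k} → Vec ℤₚ k → Vec ℕ k → ℤₚ
  monomial x α = Vec.foldr′ _*_ 1# (Vec.zipWith _^_ x α)

  -- All α ∈ ℕᵏ with |α| ≤ n, each exactly once.
  exponentsUpTo : ∀ k → ℕ → List (Vec ℕ k)
  exponentsUpTo zero    n = [] ∷ []
  exponentsUpTo (suc k) n =
    List.concatMap (λ i → List.map (i ∷_) (exponentsUpTo k (n ∸ i))) (List.upTo (suc n))

  partialSum : ∀ {k} → PowerSeries k → Vec ℤₚ k → ℕ → ℤₚ
  partialSum {k} F x n =
    List.foldr _+_ 0# (List.map (λ α → F α * monomial x α) (exponentsUpTo k n))

  infix 4 _⟦_⟧≈_

  -- F(x) = y, the value F(x) being the p-adic limit of the partial sums.
  _⟦_⟧≈_ : ∀ {k} → PowerSeries k → Vec ℤₚ k → ℤₚ → Set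
  F ⟦ x ⟧≈ y = partialSum F x ⟶ y

  AnalyticOfLevel : ℕ → Func ℤₚ-setoid ℤₚ-setoid → Set
  AnalyticOfLevel m f = ∀ a → ∃ λ (Fₐ : PowerSeries 1) →
    Restricted Fₐ × (∀ u → Fₐ ⟦ u ∷ [] ⟧≈ Func.to f (a + pₚ ^ m * u))

  I′ : ∀ {m} → Vec ℕ m → Set
  I′ β = ∀ i → Vec.lookup β i ≤ p ∸ 1

  -- F = Σ_{n ≥ 0} Σ_{β ∈ I′} a_{β,n} x₀^β₀ ⋯ xₘ₋₁^βₘ₋₁ xₘⁿ, i.e. the
  -- coefficient of x₀^β₀ ⋯ xₘ₋₁^βₘ₋₁ xₘⁿ is zero unless β ∈ I′.
  SupportedOnI′ : ∀ {m} → PowerSeries (suc m) → Set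
  SupportedOnI′ F = ∀ α → ¬ I′ (Vec.init α) → F α ≈ 0#

  δ-jet : ∀ m → ℤₚ → Vec ℤₚ (suc m)
  δ-jet m a = Vec.iterate δ a (suc m)

{-# OPTIONS --safe #-}

-- For every v ∈ ℤₚ the equation x = xᵖ + pv has exactly one root rᵢ(v) in each residue class
-- i mod p; the root is an analytic function of v, congruent to a constant mod p, and δ(x) = v holds
-- exactly when x is one of the rᵢ(v). Lagrange interpolation at these p points therefore gives
-- f(x) = Σ_{β<p} x^β g_β(δx), and because rᵢ contracts distances by p, the g_β are analytic of
-- level m when f is analytic of level m + 1. Induction on m yields F. Conversely, if F vanishes on
-- all jets, then for fixed v the polynomial Σ_β x^β F_β(v, δv, …) of degree less than p has the p
-- roots rᵢ(v), whose differences are units, so all F_β vanish on jets; for m = 0 a power series that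
-- vanishes at all powers of p is zero.

module Submission where

open import Algebra.Bundles using (CommutativeRing)
import Algebra.Properties.Ring as RingProperties
import Algebra.Properties.Semiring.Divisibility as Divisibility
import Algebra.Properties.Semiring.Exp as Exp
import Algebra.Properties.Semiring.Mult as Mult
import Algebra.Properties.Semiring.Sum as Sum
import Algebra.Solver.Ring as RingSolver
open import Algebra.Solver.Ring.AlmostCommutativeRing using (fromCommutativeRing; _-Raw-AlmostCommutative⟶_)
open import Data.Fin.Base as Fin using (Fin; toℕ)
import Data.Fin.Properties as Fin
open import Data.Integer.Base as ℤ using (ℤ; +_; -[1+_])
import Data.Integer.Divisibility.Signed as ℤ∣
import Data.Integer.DivMod as ℤ/
import Data.Integer.Properties as ℤ
open import Data.Integer.Tactic.RingSolver using (solve-∀)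
open import Data.List.Base as List using (List; []; _∷_)
import Data.List.Properties as List
open import Data.Maybe.Base using (Maybe; just; nothing)
open import Data.Nat.Base as ℕ using (ℕ; zero; suc; _≤_; _<_; _∸_; z≤n; s≤s)
open import Data.Nat.Coprimality using (prime⇒coprime; coprime-Bézout)
open import Data.Nat.GCD using (module Bézout)
open import Data.Nat.Primality using (Prime; ¬prime[0])
import Data.Nat.Properties as ℕ
open import Data.Product using (∃; ∃!; _×_; _,_; proj₁; proj₂)
open import Data.Vec.Base as Vec using (Vec; []; _∷_)
import Data.Vec.Properties as Vec
open import Data.Vec.Relation.Binary.Pointwise.Inductive using (Pointwise; []; _∷_)
open import Defs
open import Function.Base using (_∘_)
open import Function.Bundles using (Func)
open import Level using (0ℓ)
open import Relation.Binary.Definitions using (tri<; tri≈; tri>)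
open import Relation.Binary.PropositionalEquality as ≡ using (_≡_; _≢_; refl; cong; subst)
open import Relation.Nullary.Decidable using (yes; no)
open import Relation.Nullary.Negation using (¬_; contradiction)

-- Interpolation stays integral because P(x) = xᵖ - x + pv has derivative p rᵖ⁻¹ - 1 at a root r, a
-- unit given by a geometric series; the p residue classes account for the bound p - 1 on the
-- exponents. The obstacle is composition: the roots are themselves limits, and substituting them
-- into restricted series coefficient by coefficient would mean rearranging double series. Analytic
-- functions are therefore kept in the form Σ πᵏ Pₖ(u) with polynomials Pₖ of arbitrary degree.
-- Modulo πᴺ only N polynomials matter, and products, composites and infinite sums become
-- regroupings by powers of π. Power series by coefficients occur only on entering and leaving this
-- form. The algebra takes place in an abstract ring with p-adic digits, where limits are compared
-- modulo every power of π and `separated` turns this into equality. Uniqueness is likewise argued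
-- on truncations modulo πᴺ instead of on the values of the slices F_β.

-- Ring identities with integer coefficients

module IntegerSolver (R : CommutativeRing 0ℓ 0ℓ) where

  open CommutativeRing R hiding (refl)
  open RingProperties ring using (-0#≈0#; -‿distribˡ-*; -‿involutive; -‿+-comm)
  open Mult semiring using (×-homo-+; ×1-homo-*) renaming (_×_ to _·_)
  private module R = CommutativeRing R
  open import Relation.Binary.Reasoning.Setoid setoid

  fromℤ : ℤ → Carrier
  fromℤ (+ n)    = n · 1#
  fromℤ -[1+ n ] = - (suc n · 1#)

  private
    shift : ∀ a b → a + - b ≈ (1# + a) + - (1# + b)
    shift a b = begin
      a + - b                   ≈⟨ +-congʳ (+-identityˡ a) ⟨
      (0# + a) + - b            ≈⟨ +-congʳ (+-congʳ (-‿inverseʳ 1#)) ⟨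
      ((1# + - 1#) + a) + - b   ≈⟨ +-congʳ (+-assoc 1# (- 1#) a) ⟩
      (1# + (- 1# + a)) + - b   ≈⟨ +-congʳ (+-congˡ (+-comm (- 1#) a)) ⟩
      (1# + (a + - 1#)) + - b   ≈⟨ +-congʳ (+-assoc 1# a (- 1#)) ⟨
      ((1# + a) + - 1#) + - b   ≈⟨ +-assoc (1# + a) (- 1#) (- b) ⟩
      (1# + a) + (- 1# + - b)   ≈⟨ +-congˡ (-‿+-comm 1# b) ⟩
      (1# + a) + - (1# + b)     ∎

  ⊖-homo : ∀ m n → fromℤ (m ℤ.⊖ n) ≈ m · 1# + - (n · 1#)
  ⊖-homo zero    zero    = sym (-‿inverseʳ 0#)
  ⊖-homo zero    (suc n) = sym (+-identityˡ _)
  ⊖-homo (suc m) zero    = sym (trans (+-congˡ -0#≈0#) (+-identityʳ _))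
  ⊖-homo (suc m) (suc n) = begin
    fromℤ (suc m ℤ.⊖ suc n)               ≡⟨ cong fromℤ (ℤ.[1+m]⊖[1+n]≡m⊖n m n) ⟩
    fromℤ (m ℤ.⊖ n)                       ≈⟨ ⊖-homo m n ⟩
    m · 1# + - (n · 1#)                   ≈⟨ shift (m · 1#) (n · 1#) ⟩
    suc m · 1# + - (suc n · 1#)           ∎

  fromℤ-+ : ∀ i j → fromℤ (i ℤ.+ j) ≈ fromℤ i + fromℤ j
  fromℤ-+ (+ m)    (+ n)    = ×-homo-+ 1# m n
  fromℤ-+ (+ m)    -[1+ n ] = ⊖-homo m (suc n)
  fromℤ-+ -[1+ m ] (+ n)    = trans (⊖-homo n (suc m)) (+-comm _ _)
  fromℤ-+ -[1+ m ] -[1+ n ] = begin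
    - (suc (suc (m ℕ.+ n)) · 1#)          ≡⟨ cong (λ k → - (k · 1#)) (cong suc (ℕ.+-suc m n)) ⟨
    - ((suc m ℕ.+ suc n) · 1#)            ≈⟨ -‿cong (×-homo-+ 1# (suc m) (suc n)) ⟩
    - (suc m · 1# + suc n · 1#)           ≈⟨ -‿+-comm _ _ ⟨
    - (suc m · 1#) + - (suc n · 1#)       ∎

  fromℤ-neg : ∀ i → fromℤ (ℤ.- i) ≈ - fromℤ i
  fromℤ-neg (+ zero)  = sym -0#≈0#
  fromℤ-neg (+ suc n) = R.refl
  fromℤ-neg -[1+ n ]  = sym (-‿involutive _)

  private
    *-pos : ∀ m j → fromℤ (+ m ℤ.* j) ≈ (m · 1#) * fromℤ j
    *-pos m (+ n) = begin
      fromℤ (+ m ℤ.* + n)   ≡⟨ cong fromℤ (ℤ.pos-* m n) ⟨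
      (m ℕ.* n) · 1#        ≈⟨ ×1-homo-* m n ⟩
      (m · 1#) * (n · 1#)   ∎
    *-pos m -[1+ n ] = begin
      fromℤ (+ m ℤ.* -[1+ n ])      ≡⟨ cong fromℤ (ℤ.neg-distribʳ-* (+ m) (+ suc n)) ⟨
      fromℤ (ℤ.- (+ m ℤ.* + suc n)) ≈⟨ fromℤ-neg (+ m ℤ.* + suc n) ⟩
      - fromℤ (+ m ℤ.* + suc n)     ≈⟨ -‿cong (*-pos m (+ suc n)) ⟩
      - ((m · 1#) * (suc n · 1#))   ≈⟨ RingProperties.-‿distribʳ-* ring _ _ ⟩
      (m · 1#) * - (suc n · 1#)     ∎

  fromℤ-* : ∀ i j → fromℤ (i ℤ.* j) ≈ fromℤ i * fromℤ j
  fromℤ-* (+ m)    j = *-pos m j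
  fromℤ-* -[1+ m ] j = begin
    fromℤ (-[1+ m ] ℤ.* j)      ≡⟨ cong fromℤ (ℤ.neg-distribˡ-* (+ suc m) j) ⟨
    fromℤ (ℤ.- (+ suc m ℤ.* j)) ≈⟨ fromℤ-neg (+ suc m ℤ.* j) ⟩
    - fromℤ (+ suc m ℤ.* j)     ≈⟨ -‿cong (*-pos (suc m) j) ⟩
    - ((suc m · 1#) * fromℤ j)  ≈⟨ -‿distribˡ-* _ _ ⟩
    - (suc m · 1#) * fromℤ j    ∎

  private
    -- The solver needs 1 to be interpreted by 1# itself, not by 1# + 0#.
    ⟦_⟧ᶜ : ℤ → Carrier
    ⟦ + 1 ⟧ᶜ = 1#
    ⟦ i   ⟧ᶜ = fromℤ i

    ⟦⟧ᶜ≈fromℤ : ∀ i → ⟦ i ⟧ᶜ ≈ fromℤ i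
    ⟦⟧ᶜ≈fromℤ (+ 0)           = R.refl
    ⟦⟧ᶜ≈fromℤ (+ 1)           = sym (+-identityʳ 1#)
    ⟦⟧ᶜ≈fromℤ (+ suc (suc n)) = R.refl
    ⟦⟧ᶜ≈fromℤ -[1+ n ]        = R.refl

    homo₂ : ∀ (_∙_ : ℤ → ℤ → ℤ) (_◦_ : Carrier → Carrier → Carrier) →
      (∀ {a b c d} → a ≈ b → c ≈ d → (a ◦ c) ≈ (b ◦ d)) →
      (∀ i j → fromℤ (i ∙ j) ≈ (fromℤ i ◦ fromℤ j)) →
      ∀ i j → ⟦ i ∙ j ⟧ᶜ ≈ (⟦ i ⟧ᶜ ◦ ⟦ j ⟧ᶜ)
    homo₂ _∙_ _◦_ ◦-cong homo i j = trans (⟦⟧ᶜ≈fromℤ (i ∙ j)) (trans (homo i j)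
      (◦-cong (sym (⟦⟧ᶜ≈fromℤ i)) (sym (⟦⟧ᶜ≈fromℤ j))))

    morphism : ℤ.+-*-rawRing -Raw-AlmostCommutative⟶ fromCommutativeRing R
    morphism = record
      { ⟦_⟧    = ⟦_⟧ᶜ
      ; +-homo = homo₂ ℤ._+_ _+_ +-cong fromℤ-+
      ; *-homo = homo₂ ℤ._*_ _*_ *-cong fromℤ-*
      ; -‿homo = λ i → trans (⟦⟧ᶜ≈fromℤ (ℤ.- i)) (trans (fromℤ-neg i) (-‿cong (sym (⟦⟧ᶜ≈fromℤ i))))
      ; 0-homo = R.refl
      ; 1-homo = R.refl
      }

    _≟ᶜ_ : ∀ i j → Maybe (⟦ i ⟧ᶜ ≈ ⟦ j ⟧ᶜ)
    i ≟ᶜ j with i ℤ.≟ j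
    ... | yes eq = just (reflexive (cong ⟦_⟧ᶜ eq))
    ... | no  _  = nothing

  open RingSolver ℤ.+-*-rawRing (fromCommutativeRing R) morphism _≟ᶜ_ public
    using (solve; con; _:=_; _:+_; _:*_; _:-_; :-_)

-- Abstract p-adic rings: congruences and infinite sums

-- The properties of ℤₚ from which everything follows: `π` = p is no zero divisor, the π-adic
-- topology is separated and complete, and the residue field has p elements. Completeness is the
-- operation `inf`, specified by a single unfolding equation. Writing p as `suc q` makes the
-- exponent p - 1 available as `q`.
record AdicRing (q : ℕ) : Set₁ where
  field
    commutativeRing : CommutativeRing 0ℓ 0ℓ

  open CommutativeRing commutativeRing public
    hiding (zero) renaming (refl to ≈-refl; sym to ≈-sym; trans to ≈-trans)
  open Exp semiring public using (_^_; ^-congˡ; ^-congʳ; ^-homo-*)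
  open Mult semiring public using () renaming (_×_ to _·_)

  private p = suc q

  field
    π         : Carrier
    π≈p·1     : π ≈ p · 1#
    π-cancel  : ∀ {x} → π * x ≈ 0# → x ≈ 0#
    separated : ∀ {x} → (∀ n → ∃ λ y → x ≈ π ^ n * y) → x ≈ 0#
    -- The sum of d₀ + π d₁ + π² d₂ + ⋯.
    inf        : (ℕ → Carrier) → Carrier
    inf-unfold : ∀ d → inf d ≈ d 0 + π * inf (d ∘ suc)
    δ         : Carrier → Carrier
    δ-spec    : ∀ a → π * δ a ≈ a - a ^ p
    residue   : ∀ x → ∃ λ (i : Fin p) → ∃ λ y → x ≈ toℕ i · 1# + π * y
    residues-distinct : ∀ {i j : Fin p} → i ≢ j →
      ∃ λ u → ∃ λ v → (toℕ i · 1# - toℕ j · 1#) * u ≈ 1# + π * v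

module AdicCongruence {q : ℕ} (A : AdicRing q) where

  open AdicRing A
  open IntegerSolver commutativeRing using (solve; con; _:=_; _:+_; _:*_; _:-_; :-_)
  open Sum semiring using (sum)
  open import Relation.Binary.Reasoning.Setoid setoid

  infix 4 _≈_mod_

  record _≈_mod_ (x y : Carrier) (n : ℕ) : Set where
    constructor congruent
    field
      quot     : Carrier
      equation : x ≈ y + π ^ n * quot

  mod-≈ : ∀ {n x y} → x ≈ y → x ≈ y mod n
  mod-≈ {n} {x} {y} e = congruent 0# (≈-trans e
    (solve 2 (λ y w → y := y :+ w :* con (+ 0)) ≈-refl y (π ^ n)))

  mod-refl : ∀ {n x} → x ≈ x mod n
  mod-refl = mod-≈ ≈-refl

  mod-sym : ∀ {n x y} → x ≈ y mod n → y ≈ x mod n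
  mod-sym {n} {x} {y} (congruent k e) = congruent (- k) (≈-trans
    (solve 3 (λ y w k → y := (y :+ w :* k) :+ w :* (:- k)) ≈-refl y (π ^ n) k)
    (+-congʳ (≈-sym e)))

  mod-trans : ∀ {n x y z} → x ≈ y mod n → y ≈ z mod n → x ≈ z mod n
  mod-trans {n} {x} {y} {z} (congruent k e) (congruent l f) = congruent (l + k) (≈-trans e (≈-trans (+-congʳ f)
    (solve 4 (λ z w k l → (z :+ w :* l) :+ w :* k := z :+ w :* (l :+ k)) ≈-refl z (π ^ n) k l)))

  mod-+ : ∀ {n x y u v} → x ≈ y mod n → u ≈ v mod n → x + u ≈ y + v mod n
  mod-+ {n} {x} {y} {u} {v} (congruent k e) (congruent l f) = congruent (k + l) (≈-trans (+-cong e f)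
    (solve 5 (λ y v w k l → (y :+ w :* k) :+ (v :+ w :* l) := (y :+ v) :+ w :* (k :+ l))
      ≈-refl y v (π ^ n) k l))

  mod-* : ∀ {n x y u v} → x ≈ y mod n → u ≈ v mod n → x * u ≈ y * v mod n
  mod-* {n} {x} {y} {u} {v} (congruent k e) (congruent l f) = congruent (k * v + y * l + π ^ n * k * l)
    (≈-trans (*-cong e f)
    (solve 5 (λ y v w k l → (y :+ w :* k) :* (v :+ w :* l)
        := (y :* v) :+ w :* ((k :* v :+ y :* l) :+ w :* k :* l))
      ≈-refl y v (π ^ n) k l))

  mod-neg : ∀ {n x y} → x ≈ y mod n → - x ≈ - y mod n
  mod-neg {n} {x} {y} (congruent k e) = congruent (- k) (≈-trans (-‿cong e)
    (solve 3 (λ y w k → :- (y :+ w :* k) := :- y :+ w :* (:- k)) ≈-refl y (π ^ n) k))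

  mod-^ : ∀ {n x y} k → x ≈ y mod n → x ^ k ≈ y ^ k mod n
  mod-^ zero    e = mod-refl
  mod-^ (suc k) e = mod-* e (mod-^ k e)

  mod-zero : ∀ {x y} → x ≈ y mod 0
  mod-zero {x} {y} = congruent (x - y)
    (solve 2 (λ x y → x := y :+ con (+ 1) :* (x :- y)) ≈-refl x y)

  mod-π : ∀ {n x y} → x ≈ y mod n → π * x ≈ π * y mod suc n
  mod-π {n} {x} {y} (congruent k e) = congruent k (≈-trans (*-congˡ e)
    (solve 4 (λ y w π k → π :* (y :+ w :* k) := π :* y :+ (π :* w) :* k) ≈-refl y (π ^ n) π k))

  mod-≤ : ∀ {m n x y} → m ≤ n → x ≈ y mod n → x ≈ y mod m
  mod-≤ {m} {n} {x} {y} m≤n (congruent k e) = congruent (π ^ (n ∸ m) * k) (begin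
    x                               ≈⟨ e ⟩
    y + π ^ n * k                   ≈⟨ +-congˡ (*-congʳ (^-congʳ π (ℕ.m+[n∸m]≡n m≤n))) ⟨
    y + π ^ (m ℕ.+ (n ∸ m)) * k     ≈⟨ +-congˡ (*-congʳ (^-homo-* π m (n ∸ m))) ⟩
    y + π ^ m * π ^ (n ∸ m) * k     ≈⟨ +-congˡ (*-assoc _ _ _) ⟩
    y + π ^ m * (π ^ (n ∸ m) * k)   ∎)

  x-y≈0⇒x≈y : ∀ {x y} → x - y ≈ 0# → x ≈ y
  x-y≈0⇒x≈y {x} {y} e = begin
    x             ≈⟨ solve 2 (λ x y → x := (x :- y) :+ y) ≈-refl x y ⟩
    (x - y) + y   ≈⟨ +-congʳ e ⟩
    0# + y        ≈⟨ +-identityˡ y ⟩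
    y             ∎

  mod-separated : ∀ {x y} → (∀ n → x ≈ y mod n) → x ≈ y
  mod-separated {x} {y} h = x-y≈0⇒x≈y (separated λ n → let open _≈_mod_ (h n) in quot , (begin
    x - y                    ≈⟨ +-congʳ equation ⟩
    (y + π ^ n * quot) - y   ≈⟨ solve 2 (λ y k → (y :+ k) :- y := k) ≈-refl y _ ⟩
    π ^ n * quot             ∎))

  π-cancel-≈ : ∀ {x y} → π * x ≈ π * y → x ≈ y
  π-cancel-≈ {x} {y} e = x-y≈0⇒x≈y (π-cancel (begin
    π * (x - y)     ≈⟨ solve 3 (λ π x y → π :* (x :- y) := π :* x :- π :* y) ≈-refl π x y ⟩
    π * x - π * y   ≈⟨ +-congʳ e ⟩
    π * y - π * y   ≈⟨ -‿inverseʳ _ ⟩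
    0#              ∎))

  mod-π-cancel : ∀ {n x y} → π * x ≈ π * y mod suc n → x ≈ y mod n
  mod-π-cancel {n} {x} {y} (congruent k e) = congruent k (π-cancel-≈ (≈-trans e
    (solve 4 (λ y w π k → π :* y :+ (π :* w) :* k := π :* (y :+ w :* k)) ≈-refl y (π ^ n) π k)))

  mod-π^ : ∀ {n x} k → π ^ k * x ≈ 0# mod (k ℕ.+ n) → x ≈ 0# mod n
  mod-π^ {n} {x} zero    e = mod-trans (mod-≈ (≈-sym (*-identityˡ x))) e
  mod-π^ {n} {x} (suc k) e = mod-π^ k (mod-π-cancel
    (mod-trans (mod-≈ (≈-sym (*-assoc π (π ^ k) x))) (mod-trans e (mod-≈ (≈-sym (zeroʳ π))))))

  mod-sum : ∀ {n k} {f g : Fin k → Carrier} → (∀ i → f i ≈ g i mod n) → sum f ≈ sum g mod n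
  mod-sum {k = zero}  e = mod-refl
  mod-sum {k = suc k} e = mod-+ (e Fin.zero) (mod-sum (e ∘ Fin.suc))

  -- Horner form of d₀ + π d₁ + ⋯ + πⁿ⁻¹ dₙ₋₁, peeled from the front like `inf-unfold`.
  psum : (ℕ → Carrier) → ℕ → Carrier
  psum d zero    = 0#
  psum d (suc n) = d 0 + π * psum (d ∘ suc) n

  psum-suc : ∀ d n → psum d (suc n) ≈ psum d n + π ^ n * d n
  psum-suc d zero    = solve 2 (λ a π → a :+ π :* con (+ 0) := con (+ 0) :+ con (+ 1) :* a)
    ≈-refl (d 0) π
  psum-suc d (suc n) = ≈-trans (+-congˡ (*-congˡ (psum-suc (d ∘ suc) n)))
    (solve 5 (λ a π s w e → a :+ π :* (s :+ w :* e) := (a :+ π :* s) :+ (π :* w) :* e)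
      ≈-refl (d 0) π (psum (d ∘ suc) n) (π ^ n) (d (suc n)))

  -- Each unfolding pushes the unknown tail one power of `π` further. With `mod-separated` this
  -- shows that `inf-unfold` determines `inf`.
  inf-psum : ∀ d n → inf d ≈ psum d n mod n
  inf-psum d zero    = mod-zero
  inf-psum d (suc n) = mod-trans (mod-≈ (inf-unfold d))
    (mod-+ mod-refl (mod-π (inf-psum (d ∘ suc) n)))

  inf-cong-mod : ∀ n {d e} → (∀ k → d k ≈ e k mod n) → inf d ≈ inf e mod n
  inf-cong-mod n {d} {e} h = mod-trans (inf-psum d n)
    (mod-trans (psum-cong n h) (mod-sym (inf-psum e n)))
    where
    psum-cong : ∀ k {d e} → (∀ k → d k ≈ e k mod n) → psum d k ≈ psum e k mod n
    psum-cong zero    h = mod-refl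
    psum-cong (suc k) h = mod-+ (h 0) (mod-* mod-refl (psum-cong k (h ∘ suc)))

  inf-cong : ∀ {d e} → (∀ k → d k ≈ e k) → inf d ≈ inf e
  inf-cong h = mod-separated λ n → inf-cong-mod n λ k → mod-≈ (h k)

  inf-0 : inf (λ _ → 0#) ≈ 0#
  inf-0 = mod-separated go
    where
    go : ∀ n → inf (λ _ → 0#) ≈ 0# mod n
    go zero    = mod-zero
    go (suc n) = mod-trans (mod-≈ (inf-unfold _))
      (mod-trans (mod-+ mod-refl (mod-π (go n)))
        (mod-≈ (solve 1 (λ π → con (+ 0) :+ π :* con (+ 0) := con (+ 0)) ≈-refl π)))

  inf-+ : ∀ d e → inf d + inf e ≈ inf (λ k → d k + e k)
  inf-+ d e = mod-separated (go d e)
    where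
    go : ∀ d e n → inf d + inf e ≈ inf (λ k → d k + e k) mod n
    go d e zero    = mod-zero
    go d e (suc n) = mod-trans (mod-≈ (≈-trans (+-cong (inf-unfold d) (inf-unfold e))
        (solve 5 (λ a x b y π → (a :+ π :* x) :+ (b :+ π :* y) := (a :+ b) :+ π :* (x :+ y))
          ≈-refl (d 0) (inf (d ∘ suc)) (e 0) (inf (e ∘ suc)) π)))
      (mod-trans (mod-+ mod-refl (mod-π (go (d ∘ suc) (e ∘ suc) n)))
        (mod-≈ (≈-sym (inf-unfold _))))

  inf-* : ∀ c d → c * inf d ≈ inf (λ k → c * d k)
  inf-* c d = mod-separated (go d)
    where
    go : ∀ d n → c * inf d ≈ inf (λ k → c * d k) mod n
    go d zero    = mod-zero
    go d (suc n) = mod-trans (mod-≈ (≈-trans (*-congˡ (inf-unfold d))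
        (solve 4 (λ a x c π → c :* (a :+ π :* x) := c :* a :+ π :* (c :* x))
          ≈-refl (d 0) (inf (d ∘ suc)) c π)))
      (mod-trans (mod-+ mod-refl (mod-π (go (d ∘ suc) n)))
        (mod-≈ (≈-sym (inf-unfold _))))

  -- The geometric series in -πv.
  [1+π_]⁻¹ : Carrier → Carrier
  [1+π v ]⁻¹ = inf ((- v) ^_)

  *-inverse-1+π : ∀ v → (1# + π * v) * [1+π v ]⁻¹ ≈ 1#
  *-inverse-1+π v = begin
    (1# + π * v) * w                  ≈⟨ solve 3 (λ π v w → (con (+ 1) :+ π :* v) :* w
                                           := w :- π :* ((:- v) :* w)) ≈-refl π v w ⟩
    w - π * (- v * w)                 ≈⟨ +-congʳ w-fix ⟩
    (1# + π * (- v * w)) - π * (- v * w)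
      ≈⟨ solve 1 (λ x → (con (+ 1) :+ x) :- x := con (+ 1)) ≈-refl _ ⟩
    1#                                ∎
    where
    w = [1+π v ]⁻¹
    w-fix : w ≈ 1# + π * (- v * w)
    w-fix = ≈-trans (inf-unfold _) (+-congˡ (*-congˡ (≈-sym (inf-* (- v) ((- v) ^_)))))

-- Analytic functions as π-adic sums of polynomials

module AnalyticFunctions {q : ℕ} (A : AdicRing q) where

  open AdicRing A
  open AdicCongruence A
  open IntegerSolver commutativeRing using (solve; con; _:=_; _:+_; _:*_; _:-_; :-_)
  open Sum semiring using (sum)
  open import Relation.Binary.Reasoning.Setoid setoid

  Poly : Set
  Poly = List Carrier

  eval : Poly → Carrier → Carrier
  eval []      u = 0#
  eval (c ∷ P) u = c + u * eval P u

  infixl 6 _⊕_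
  infixl 7 _⊛_ _⊗_

  _⊕_ : Poly → Poly → Poly
  []      ⊕ Q       = Q
  (c ∷ P) ⊕ []      = c ∷ P
  (c ∷ P) ⊕ (d ∷ Q) = (c + d) ∷ (P ⊕ Q)

  _⊛_ : Carrier → Poly → Poly
  c ⊛ Q = List.map (c *_) Q

  _⊗_ : Poly → Poly → Poly
  []      ⊗ Q = []
  (c ∷ P) ⊗ Q = (c ⊛ Q) ⊕ (0# ∷ (P ⊗ Q))

  eval-⊕ : ∀ P Q u → eval (P ⊕ Q) u ≈ eval P u + eval Q u
  eval-⊕ []      Q       u = ≈-sym (+-identityˡ _)
  eval-⊕ (c ∷ P) []      u = ≈-sym (+-identityʳ _)
  eval-⊕ (c ∷ P) (d ∷ Q) u = ≈-trans (+-congˡ (*-congˡ (eval-⊕ P Q u)))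
    (solve 5 (λ c d u x y → (c :+ d) :+ u :* (x :+ y) := (c :+ u :* x) :+ (d :+ u :* y))
      ≈-refl c d u (eval P u) (eval Q u))

  eval-⊛ : ∀ c Q u → eval (c ⊛ Q) u ≈ c * eval Q u
  eval-⊛ c []      u = ≈-sym (zeroʳ c)
  eval-⊛ c (d ∷ Q) u = ≈-trans (+-congˡ (*-congˡ (eval-⊛ c Q u)))
    (solve 4 (λ c d u x → c :* d :+ u :* (c :* x) := c :* (d :+ u :* x)) ≈-refl c d u (eval Q u))

  eval-⊗ : ∀ P Q u → eval (P ⊗ Q) u ≈ eval P u * eval Q u
  eval-⊗ []      Q u = ≈-sym (zeroˡ _)
  eval-⊗ (c ∷ P) Q u = ≈-trans (eval-⊕ (c ⊛ Q) (0# ∷ (P ⊗ Q)) u)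
    (≈-trans (+-cong (eval-⊛ c Q u) (+-congˡ (*-congˡ (eval-⊗ P Q u))))
      (solve 4 (λ c u x y → c :* y :+ (con (+ 0) :+ u :* (x :* y)) := (c :+ u :* x) :* y)
        ≈-refl c u (eval P u) (eval Q u)))

  -- Restricted power series are encoded as sums Σ πᵏ Pₖ of polynomials; the coefficients of such
  -- a sum tend to zero, whatever the degrees of the Pₖ.
  record Analytic (f : Carrier → Carrier) : Set where
    constructor analytic
    field
      digits : ℕ → Poly
      expand : ∀ u → f u ≈ inf (λ k → eval (digits k) u)

  open Analytic public

  analytic-cong : ∀ {f g} → (∀ u → f u ≈ g u) → Analytic g → Analytic f
  analytic-cong e (analytic P h) = analytic P λ u → ≈-trans (e u) (h u)

  analytic-eval : ∀ P → Analytic (eval P)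
  analytic-eval P = analytic Ps λ u → ≈-sym (begin
    inf (λ k → eval (Ps k) u)     ≈⟨ inf-unfold _ ⟩
    eval P u + π * inf (λ _ → 0#) ≈⟨ +-congˡ (*-congˡ inf-0) ⟩
    eval P u + π * 0#             ≈⟨ solve 2 (λ x π → x :+ π :* con (+ 0) := x) ≈-refl _ π ⟩
    eval P u                      ∎)
    where
    Ps : ℕ → Poly
    Ps zero    = P
    Ps (suc _) = []

  analytic-const : ∀ c → Analytic (λ _ → c)
  analytic-const c = analytic-cong
    (λ u → solve 2 (λ c u → c := c :+ u :* con (+ 0)) ≈-refl c u) (analytic-eval (c ∷ []))

  analytic-id : Analytic (λ u → u)
  analytic-id = analytic-cong
    (λ u → solve 1 (λ u → u := con (+ 0) :+ u :* (con (+ 1) :+ u :* con (+ 0))) ≈-refl u)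
    (analytic-eval (0# ∷ 1# ∷ []))

  analytic-+ : ∀ {f g} → Analytic f → Analytic g → Analytic (λ u → f u + g u)
  analytic-+ (analytic P f≈) (analytic Q g≈) = analytic (λ k → P k ⊕ Q k) λ u →
    ≈-trans (+-cong (f≈ u) (g≈ u))
      (≈-trans (inf-+ _ _) (inf-cong λ k → ≈-sym (eval-⊕ (P k) (Q k) u)))

  private
    -- The digits of Σ πᵏ Eₖ + Σ πⁿ⁺ᵏ Pₙₖ; the accumulator E collects what is carried along.
    diagonal : (ℕ → Poly) → (ℕ → ℕ → Poly) → ℕ → Poly
    diagonal E P zero    = E 0 ⊕ P 0 0
    diagonal E P (suc n) = diagonal (λ k → E (suc k) ⊕ P 0 (suc k)) (P ∘ suc) n

    eval-diagonal : ∀ u n E P →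
      inf (λ k → eval (E k) u) + inf (λ n → inf (λ k → eval (P n k) u))
        ≈ inf (λ k → eval (diagonal E P k) u) mod n
    eval-diagonal u zero    E P = mod-zero
    eval-diagonal u (suc n) E P = mod-trans
      (mod-≈ (begin
        inf e + inf (λ n → inf (d n))
          ≈⟨ +-cong (inf-unfold e) (≈-trans (inf-unfold _) (+-congʳ (inf-unfold (d 0)))) ⟩
        (e 0 + π * x) + ((d 0 0 + π * y) + π * z)
          ≈⟨ solve 6 (λ a b π x y z → (a :+ π :* x) :+ ((b :+ π :* y) :+ π :* z)
               := (a :+ b) :+ π :* ((x :+ y) :+ z)) ≈-refl (e 0) (d 0 0) π x y z ⟩
        (e 0 + d 0 0) + π * ((x + y) + z)
          ≈⟨ +-cong (≈-sym (eval-⊕ (E 0) (P 0 0) u)) (*-congˡ (+-congʳ (≈-trans (inf-+ _ _)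
               (inf-cong λ k → ≈-sym (eval-⊕ (E (suc k)) (P 0 (suc k)) u))))) ⟩
        eval (E 0 ⊕ P 0 0) u + π * (inf (λ k → eval (E′ k) u) + z) ∎))
      (mod-trans (mod-+ mod-refl (mod-π (eval-diagonal u n E′ (P ∘ suc))))
        (mod-≈ (≈-sym (inf-unfold _))))
      where
      e : ℕ → Carrier
      e k = eval (E k) u
      d : ℕ → ℕ → Carrier
      d n k = eval (P n k) u
      E′ : ℕ → Poly
      E′ k = E (suc k) ⊕ P 0 (suc k)
      x y z : Carrier
      x = inf (e ∘ suc)
      y = inf (d 0 ∘ suc)
      z = inf (λ n → inf (d (suc n)))

  -- Grouping the double sum Σ πⁿ⁺ᵏ Pₙₖ by n + k leaves finitely many polynomials in each digit, so
  -- no bound on degrees uniform in n enters.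
  analytic-inf : ∀ {h : ℕ → Carrier → Carrier} → (∀ n → Analytic (h n)) →
    Analytic (λ u → inf (λ n → h n u))
  analytic-inf {h} H = analytic (diagonal (λ _ → []) P) λ u → begin
    inf (λ n → h n u)
      ≈⟨ inf-cong (λ n → expand (H n) u) ⟩
    inf (λ n → inf (λ k → eval (P n k) u))
      ≈⟨ ≈-trans (+-congʳ inf-0) (+-identityˡ _) ⟨
    inf (λ _ → 0#) + inf (λ n → inf (λ k → eval (P n k) u))
      ≈⟨ mod-separated (λ n → eval-diagonal u n (λ _ → []) P) ⟩
    inf (λ k → eval (diagonal (λ _ → []) P k) u) ∎
    where
    P : ℕ → ℕ → Poly
    P n = digits (H n)

  -- For each n the product of g with Pₙ is analytic digit by digit; summing over n with weights πⁿ
  -- is then a case of `analytic-inf`.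
  analytic-* : ∀ {f g} → Analytic f → Analytic g → Analytic (λ u → f u * g u)
  analytic-* {f} {g} (analytic P f≈) (analytic Q g≈) = analytic-cong
    (λ u → ≈-trans (*-comm (f u) (g u)) (≈-trans (*-congˡ (f≈ u)) (inf-* (g u) _)))
    (analytic-inf λ n → analytic (λ k → P n ⊗ Q k) λ u →
      ≈-trans (*-comm _ _) (≈-trans (*-congˡ (g≈ u)) (≈-trans (inf-* _ _)
        (inf-cong λ k → ≈-sym (eval-⊗ (P n) (Q k) u)))))

  analytic-neg : ∀ {f} → Analytic f → Analytic (λ u → - f u)
  analytic-neg {f} a = analytic-cong
    (λ u → solve 1 (λ x → :- x := con (ℤ.- (+ 1)) :* x) ≈-refl (f u))
    (analytic-* (analytic-const _) a)

  analytic-^ : ∀ {f} → Analytic f → ∀ k → Analytic (λ u → f u ^ k)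
  analytic-^ a zero    = analytic-const 1#
  analytic-^ a (suc k) = analytic-* a (analytic-^ a k)

  analytic-sum : ∀ {n} {f : Fin n → Carrier → Carrier} → (∀ i → Analytic (f i)) →
    Analytic (λ u → sum (λ i → f i u))
  analytic-sum {zero}  a = analytic-const 0#
  analytic-sum {suc n} a = analytic-+ (a Fin.zero) (analytic-sum (a ∘ Fin.suc))

  analytic-eval-∘ : ∀ {s} P → Analytic s → Analytic (λ u → eval P (s u))
  analytic-eval-∘ []      a = analytic-const 0#
  analytic-eval-∘ (c ∷ P) a = analytic-+ (analytic-const c) (analytic-* a (analytic-eval-∘ P a))

  -- A polynomial in `s` is analytic by sums and products, and Σ πⁿ Pₙ(s(u)) is again a sum of the
  -- kind that `analytic-inf` handles.
  analytic-∘ : ∀ {f s} → Analytic f → Analytic s → Analytic (λ u → f (s u))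
  analytic-∘ {s = s} (analytic P f≈) a =
    analytic-cong (λ u → f≈ (s u)) (analytic-inf λ n → analytic-eval-∘ (P n) a)

  -- The divided difference (P(y) - P(x))/(y - x), computed without division.
  slope : Poly → Carrier → Carrier → Carrier
  slope []      x y = 0#
  slope (c ∷ P) x y = eval P y + x * slope P x y

  eval-slope : ∀ P x d → eval P (x + d) ≈ eval P x + d * slope P x (x + d)
  eval-slope []      x d = solve 1 (λ d → con (+ 0) := con (+ 0) :+ d :* con (+ 0)) ≈-refl d
  eval-slope (c ∷ P) x d = begin
    c + (x + d) * e
      ≈⟨ solve 4 (λ c x d e → c :+ (x :+ d) :* e := (c :+ x :* e) :+ d :* e) ≈-refl c x d e ⟩
    (c + x * e) + d * e
      ≈⟨ +-congʳ (+-congˡ (*-congˡ (eval-slope P x d))) ⟩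
    (c + x * (eval P x + d * s)) + d * e
      ≈⟨ solve 6 (λ c x d e f s → (c :+ x :* (f :+ d :* s)) :+ d :* e
           := (c :+ x :* f) :+ d :* (e :+ x :* s)) ≈-refl c x d e (eval P x) s ⟩
    (c + x * eval P x) + d * (e + x * s) ∎
    where
    e s : Carrier
    e = eval P (x + d)
    s = slope P x (x + d)

  analytic-slope : ∀ {s} P x → Analytic s → Analytic (λ u → slope P x (s u))
  analytic-slope []      x a = analytic-const 0#
  analytic-slope (c ∷ P) x a =
    analytic-+ (analytic-eval-∘ P a) (analytic-* (analytic-const x) (analytic-slope P x a))

  -- The first-order expansion about b, obtained from divided differences. With c = πᵐ it measures
  -- how far a root moves when v moves inside a ball of radius p⁻ᵐ.
  analytic-increment : ∀ {f} → Analytic f → ∀ b c → ∃ λ s → Analytic s ×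
    (∀ u → f (b + c * u) ≈ f b + c * s u)
  analytic-increment {f} (analytic P f≈) b c = _ ,
    analytic-inf (λ k → analytic-* analytic-id (analytic-slope (P k) b
      (analytic-+ (analytic-const b) (analytic-* (analytic-const c) analytic-id)))) ,
    λ u → begin
      f (b + c * u)                                 ≈⟨ f≈ _ ⟩
      inf (λ k → eval (P k) (b + c * u))            ≈⟨ inf-cong (λ k → ≈-trans
                                                         (eval-slope (P k) b (c * u))
                                                         (+-congˡ (*-assoc c u _))) ⟩
      inf (λ k → eval (P k) b + c * (u * S k u))    ≈⟨ inf-+ _ _ ⟨
      inf (λ k → eval (P k) b) + inf (λ k → c * (u * S k u))
        ≈⟨ +-cong (f≈ b) (inf-* c _) ⟨
      f b + c * inf (λ k → u * S k u) ∎
    where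
    S : ℕ → Carrier → Carrier
    S k u = slope (P k) b (b + c * u)

-- The p roots of x = xᵖ + πv

module Roots {q : ℕ} (A : AdicRing q) where

  open AdicRing A
  open AdicCongruence A
  open AnalyticFunctions A
  open IntegerSolver commutativeRing using (solve; con; _:=_; _:+_; _:*_; _:-_; :-_)
  open Sum semiring using (sum; sum-cong-≋; *-distribˡ-sum)
  open import Relation.Binary.Reasoning.Setoid setoid

  private p = suc q

  -- (yⁿ - xⁿ)/(y - x)
  cofactor : ℕ → Carrier → Carrier → Carrier
  cofactor zero    x y = 0#
  cofactor (suc n) x y = x ^ n + y * cofactor n x y

  ^-cofactor : ∀ n x y → y ^ n ≈ x ^ n + (y - x) * cofactor n x y
  ^-cofactor zero    x y = solve 2 (λ x y → con (+ 1) := con (+ 1) :+ (y :- x) :* con (+ 0)) ≈-refl x y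
  ^-cofactor (suc n) x y = ≈-trans (*-congˡ (^-cofactor n x y))
    (solve 4 (λ x y w c → y :* (w :+ (y :- x) :* c) := x :* w :+ (y :- x) :* (w :+ y :* c))
      ≈-refl x y (x ^ n) (cofactor n x y))

  -- Expansion in powers of `y`, from which the coefficients of the Lagrange polynomials are read
  -- off.
  cofactor-sum : ∀ n x y → cofactor n x y ≈ sum {n} (λ β → y ^ toℕ β * x ^ (n ∸ suc (toℕ β)))
  cofactor-sum zero    x y = ≈-refl
  cofactor-sum (suc n) x y = +-cong (≈-sym (*-identityˡ _))
    (≈-trans (*-congˡ (cofactor-sum n x y)) (≈-trans (*-distribˡ-sum y term)
      (sum-cong-≋ {n} λ β → ≈-sym (*-assoc y _ _))))
    where
    term : Fin n → Carrier
    term β = y ^ toℕ β * x ^ (n ∸ suc (toℕ β))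

  cofactor-congˡ : ∀ n {x x′} y → x ≈ x′ → cofactor n x y ≈ cofactor n x′ y
  cofactor-congˡ zero    y e = ≈-refl
  cofactor-congˡ (suc n) y e = +-cong (^-congˡ n e) (*-congˡ (cofactor-congˡ n y e))

  -- The divided difference on the diagonal is the derivative of the power.
  cofactor-diagonal : ∀ n x → cofactor (suc n) x x ≈ (suc n · 1#) * x ^ n
  cofactor-diagonal zero    x =
    solve 1 (λ x → con (+ 1) :+ x :* con (+ 0) := (con (+ 1) :+ con (+ 0)) :* con (+ 1)) ≈-refl x
  cofactor-diagonal (suc n) x = ≈-trans (+-congˡ (*-congˡ (cofactor-diagonal n x)))
    (solve 3 (λ x w k → x :* w :+ x :* (k :* w) := (con (+ 1) :+ k) :* (x :* w))
      ≈-refl x (x ^ n) (suc n · 1#))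

  private
    -- What is left of `cofactor (suc n) x (x + π * z)` after subtracting its value at z = 0 and
    -- dividing by `π`. The explicit recursion makes it visibly analytic in x and z.
    remainder : ℕ → Carrier → Carrier → Carrier
    remainder zero    x z = 0#
    remainder (suc n) x z = z * cofactor (suc n) x (x + π * z) + x * remainder n x z

    cofactor-remainder : ∀ n x z →
      cofactor (suc n) x (x + π * z) ≈ (suc n · 1#) * x ^ n + π * remainder n x z
    cofactor-remainder zero    x z = solve 3 (λ x z π →
      con (+ 1) :+ (x :+ π :* z) :* con (+ 0) := (con (+ 1) :+ con (+ 0)) :* con (+ 1) :+ π :* con (+ 0))
      ≈-refl x z π
    cofactor-remainder (suc n) x z = begin
      x * x ^ n + (x + π * z) * c
        ≈⟨ solve 5 (λ x z π w c → x :* w :+ (x :+ π :* z) :* c := (x :* w :+ x :* c) :+ π :* (z :* c))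
             ≈-refl x z π (x ^ n) c ⟩
      (x * x ^ n + x * c) + π * (z * c)
        ≈⟨ +-congʳ (+-congˡ (*-congˡ (cofactor-remainder n x z))) ⟩
      (x * x ^ n + x * (k * x ^ n + π * r)) + π * (z * c)
        ≈⟨ solve 7 (λ x z π w c k r → (x :* w :+ x :* (k :* w :+ π :* r)) :+ π :* (z :* c)
             := (con (+ 1) :+ k) :* (x :* w) :+ π :* (z :* c :+ x :* r))
             ≈-refl x z π (x ^ n) c k r ⟩
      (1# + k) * (x * x ^ n) + π * (z * c + x * r) ∎
      where
      c k r : Carrier
      c = cofactor (suc n) x (x + π * z)
      k = suc n · 1#
      r = remainder n x z

  -- In the cofactor of exponent p, the leading term p xᵖ⁻¹ and the remainder term both carry a
  -- factor `π`; this is the cofactor with that factor removed.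
  contraction : Carrier → Carrier → Carrier
  contraction x z = x ^ q + remainder q x z

  -- Taking p-th powers brings points that agree mod π closer together.
  ^p-contracts : ∀ x z → (x + π * z) ^ p ≈ x ^ p + π * z * (π * contraction x z)
  ^p-contracts x z = begin
    y ^ p
      ≈⟨ ^-cofactor p x y ⟩
    x ^ p + (y - x) * cofactor p x y
      ≈⟨ +-congˡ (*-cong (solve 3 (λ x π z → (x :+ π :* z) :- x := π :* z) ≈-refl x π z)
           (≈-trans (cofactor-remainder q x z) (+-congʳ (*-congʳ (≈-sym π≈p·1))))) ⟩
    x ^ p + π * z * (π * x ^ q + π * remainder q x z)
      ≈⟨ +-congˡ (*-congˡ (distribˡ π _ _)) ⟨
    x ^ p + π * z * (π * contraction x z) ∎
    where
    y = x + π * z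

  analytic-cofactor : ∀ n {f g} → Analytic f → Analytic g → Analytic (λ u → cofactor n (f u) (g u))
  analytic-cofactor zero    a b = analytic-const 0#
  analytic-cofactor (suc n) a b = analytic-+ (analytic-^ a n) (analytic-* b (analytic-cofactor n a b))

  private
    analytic-remainder : ∀ n {f g} → Analytic f → Analytic g → Analytic (λ u → remainder n (f u) (g u))
    analytic-remainder zero    a b = analytic-const 0#
    analytic-remainder (suc n) a b = analytic-+
      (analytic-* b (analytic-cofactor (suc n) a (analytic-+ a (analytic-* (analytic-const π) b))))
      (analytic-* a (analytic-remainder n a b))

  analytic-contraction : ∀ {f g} → Analytic f → Analytic g → Analytic (λ u → contraction (f u) (g u))
  analytic-contraction a b = analytic-+ (analytic-^ a q) (analytic-remainder q a b)

  IsRoot : Carrier → Carrier → Set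
  IsRoot v x = x ≈ x ^ p + π * v

  isRoot-δ : ∀ x → IsRoot (δ x) x
  isRoot-δ x = ≈-sym (≈-trans (+-congˡ (δ-spec x))
    (solve 2 (λ x w → w :+ (x :- w) := x) ≈-refl x (x ^ p)))

  isRoot⇒δ : ∀ {v x} → IsRoot v x → δ x ≈ v
  isRoot⇒δ {v} {x} e = π-cancel-≈ (begin
    π * δ x                  ≈⟨ δ-spec x ⟩
    x - x ^ p                ≈⟨ +-congʳ e ⟩
    (x ^ p + π * v) - x ^ p  ≈⟨ solve 2 (λ w y → (w :+ y) :- w := y) ≈-refl (x ^ p) (π * v) ⟩
    π * v                    ∎)

  isRoot-resp : ∀ {v v′ x} → v ≈ v′ → IsRoot v x → IsRoot v′ x
  isRoot-resp e r = ≈-trans r (+-congˡ (*-congˡ e))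

  -- For d = πz the two root equations give d = d · πκ, so d(1 - πκ) = 0, and 1 - πκ is a unit.
  root-unique : ∀ {v x y} z → IsRoot v x → IsRoot v y → y ≈ x + π * z → y ≈ x
  root-unique {v} {x} {y} z rx ry e = ≈-trans e (≈-trans (+-congˡ πz≈0) (+-identityʳ x))
    where
    κ w : Carrier
    κ = contraction x z
    w = [1+π - κ ]⁻¹
    fixed : π * z ≈ π * z * (π * κ)
    fixed = begin
      π * z                   ≈⟨ solve 2 (λ x d → d := (x :+ d) :- x) ≈-refl x (π * z) ⟩
      (x + π * z) - x         ≈⟨ +-cong (≈-trans (≈-sym e) ry) (-‿cong rx) ⟩
      (y ^ p + π * v) - (x ^ p + π * v)
        ≈⟨ +-congʳ (+-congʳ (≈-trans (^-congˡ p e) (^p-contracts x z))) ⟩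
      ((x ^ p + d) + π * v) - (x ^ p + π * v)
        ≈⟨ solve 3 (λ w d v → ((w :+ d) :+ v) :- (w :+ v) := d) ≈-refl (x ^ p) d (π * v) ⟩
      d ∎
      where d = π * z * (π * κ)
    πz≈0 : π * z ≈ 0#
    πz≈0 = begin
      π * z                          ≈⟨ *-identityʳ _ ⟨
      π * z * 1#                     ≈⟨ *-congˡ (*-inverse-1+π (- κ)) ⟨
      π * z * ((1# + π * - κ) * w)
        ≈⟨ solve 4 (λ e π κ w → e :* ((con (+ 1) :+ π :* (:- κ)) :* w)
             := (e :- e :* (π :* κ)) :* w) ≈-refl (π * z) π κ w ⟩
      (π * z - π * z * (π * κ)) * w  ≈⟨ *-congʳ (+-congˡ (-‿cong fixed)) ⟨
      (π * z - π * z) * w            ≈⟨ solve 2 (λ e w → (e :- e) :* w := con (+ 0)) ≈-refl (π * z) w ⟩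
      0#                             ∎

  -- The iteration xₙ₊₁ = xₙᵖ + πv from x₀ = c, together with the digits dₙ = (xₙ₊₁ - xₙ)/πⁿ⁺¹.
  module Iteration (c : Carrier) where

    approximation digit : ℕ → Carrier → Carrier
    approximation zero    v = c
    approximation (suc n) v = approximation n v + π * (π ^ n * digit n v)
    -- The first step is cᵖ + πv - c = π(v - δc).
    digit zero    v = v - δ c
    -- xₙ₊₂ - xₙ₊₁ = xₙ₊₁ᵖ - xₙᵖ, and `^p-contracts` supplies the additional factor `π`, so the
    -- division by πⁿ⁺² is never carried out.
    digit (suc n) v = digit n v * contraction (approximation n v) (π ^ n * digit n v)

    approximation-step : ∀ n v → approximation (suc n) v ≈ approximation n v ^ p + π * v
    approximation-step zero v = begin
      c + π * (1# * (v - δ c))    ≈⟨ solve 4 (λ c π v d → c :+ π :* (con (+ 1) :* (v :- d))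
                                       := (c :- π :* d) :+ π :* v) ≈-refl c π v (δ c) ⟩
      (c - π * δ c) + π * v       ≈⟨ +-congʳ (+-congˡ (-‿cong (δ-spec c))) ⟩
      (c - (c - c ^ p)) + π * v   ≈⟨ solve 3 (λ c w v → (c :- (c :- w)) :+ v := w :+ v)
                                       ≈-refl c (c ^ p) (π * v) ⟩
      c ^ p + π * v               ∎
    approximation-step (suc n) v = begin
      approximation (suc n) v + π * (π * w * (d * κ))
        ≈⟨ +-congʳ (approximation-step n v) ⟩
      (x ^ p + π * v) + π * (π * w * (d * κ))
        ≈⟨ solve 6 (λ y π v w d κ → (y :+ π :* v) :+ π :* (π :* w :* (d :* κ))
             := (y :+ π :* (w :* d) :* (π :* κ)) :+ π :* v) ≈-refl (x ^ p) π v w d κ ⟩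
      (x ^ p + π * (w * d) * (π * κ)) + π * v
        ≈⟨ +-congʳ (^p-contracts x (w * d)) ⟨
      approximation (suc n) v ^ p + π * v ∎
      where
      x w d κ : Carrier
      x = approximation n v
      w = π ^ n
      d = digit n v
      κ = contraction x (w * d)

    approximation-psum : ∀ n v → approximation n v ≈ c + π * psum (λ k → digit k v) n
    approximation-psum zero    v = solve 2 (λ c π → c := c :+ π :* con (+ 0)) ≈-refl c π
    approximation-psum (suc n) v = begin
      approximation n v + π * e         ≈⟨ +-congʳ (approximation-psum n v) ⟩
      (c + π * s) + π * e               ≈⟨ solve 4 (λ c π s e → (c :+ π :* s) :+ π :* e
                                             := c :+ π :* (s :+ e)) ≈-refl c π s e ⟩
      c + π * (s + e)                   ≈⟨ +-congˡ (*-congˡ (psum-suc _ n)) ⟨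
      c + π * psum (λ k → digit k v) (suc n) ∎
      where
      e s : Carrier
      e = π ^ n * digit n v
      s = psum (λ k → digit k v) n

    -- The factor `π` in front of `offset` is the contraction: a change of the offset by a multiple
    -- of πᵐ changes the root by a multiple of πᵐ⁺¹.
    offset root : Carrier → Carrier
    offset v = inf (λ k → digit k v)
    root v = c + π * offset v

    root-approximation : ∀ n v → root v ≈ approximation n v mod suc n
    root-approximation n v = mod-trans (mod-+ mod-refl (mod-π (inf-psum _ n)))
      (mod-≈ (≈-sym (approximation-psum n v)))

    root-isRoot : ∀ v → IsRoot v (root v)
    root-isRoot v = mod-separated λ n → mod-≤ (ℕ.n≤1+n n)
      (mod-trans (mod-≤ (ℕ.n≤1+n (suc n)) (root-approximation (suc n) v))
        (mod-trans (mod-≈ (approximation-step n v))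
          (mod-+ (mod-^ p (mod-sym (root-approximation n v))) mod-refl)))

    analytic-approximation : ∀ n → Analytic (approximation n)
    analytic-digit : ∀ n → Analytic (digit n)
    analytic-πⁿdigit : ∀ n → Analytic (λ v → π ^ n * digit n v)
    analytic-approximation zero    = analytic-const c
    analytic-approximation (suc n) =
      analytic-+ (analytic-approximation n) (analytic-* (analytic-const π) (analytic-πⁿdigit n))
    analytic-digit zero    = analytic-+ analytic-id (analytic-const (- δ c))
    analytic-digit (suc n) = analytic-* (analytic-digit n)
      (analytic-contraction (analytic-approximation n) (analytic-πⁿdigit n))
    analytic-πⁿdigit n = analytic-* (analytic-const (π ^ n)) (analytic-digit n)

    analytic-offset : Analytic offset
    analytic-offset = analytic-inf analytic-digit

  module _ (i : Fin p) where
    open Iteration (toℕ i · 1#) public using () renaming (root to r; offset to t)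

  r-isRoot : ∀ i v → IsRoot v (r i v)
  r-isRoot i = Iteration.root-isRoot (toℕ i · 1#)

  -- Both sides are roots for `v′` in the residue class of i, so uniqueness identifies them.
  r-cong : ∀ i {v v′} → v ≈ v′ → r i v ≈ r i v′
  r-cong i {v} {v′} e = root-unique (t i v - t i v′) (r-isRoot i v′) (isRoot-resp e (r-isRoot i v))
    (solve 4 (λ c π s s′ → c :+ π :* s := (c :+ π :* s′) :+ π :* (s :- s′)) ≈-refl
      (toℕ i · 1#) π (t i v) (t i v′))

  r-surjective : ∀ x → ∃ λ i → x ≈ r i (δ x)
  r-surjective x with residue x
  ... | i , y , e = i , root-unique (y - t i (δ x)) (r-isRoot i (δ x)) (isRoot-δ x)
    (≈-trans e (solve 4 (λ c π y s → c :+ π :* y := (c :+ π :* s) :+ π :* (y :- s)) ≈-refl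
      (toℕ i · 1#) π y (t i (δ x))))

  -- The difference agrees with i - j modulo `π`. An inverse of i - j modulo `π` makes it congruent
  -- to 1, and a geometric series completes the inversion.
  r-distinct : ∀ {i j} v → i ≢ j → ∃ λ w → (r i v - r j v) * w ≈ 1#
  r-distinct {i} {j} v i≢j with residues-distinct i≢j
  ... | u , z , e = u * [1+π s ]⁻¹ , (begin
    (r i v - r j v) * (u * [1+π s ]⁻¹)
      ≈⟨ solve 7 (λ a b π x y u w → ((a :+ π :* x) :- (b :+ π :* y)) :* (u :* w)
           := ((a :- b) :* u :+ π :* ((x :- y) :* u)) :* w) ≈-refl
           (toℕ i · 1#) (toℕ j · 1#) π (t i v) (t j v) u [1+π s ]⁻¹ ⟩
    ((toℕ i · 1# - toℕ j · 1#) * u + π * ((t i v - t j v) * u)) * [1+π s ]⁻¹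
      ≈⟨ *-congʳ (+-congʳ e) ⟩
    ((1# + π * z) + π * ((t i v - t j v) * u)) * [1+π s ]⁻¹
      ≈⟨ *-congʳ (solve 3 (λ π z y → (con (+ 1) :+ π :* z) :+ π :* y := con (+ 1) :+ π :* (z :+ y))
           ≈-refl π z ((t i v - t j v) * u)) ⟩
    (1# + π * s) * [1+π s ]⁻¹
      ≈⟨ *-inverse-1+π s ⟩
    1# ∎)
    where
    s = z + (t i v - t j v) * u

-- Lagrange interpolation at the roots

module Interpolation {q : ℕ} (A : AdicRing q) where

  open AdicRing A
  open AdicCongruence A
  open AnalyticFunctions A
  open Roots A
  open IntegerSolver commutativeRing using (solve; con; _:=_; _:+_; _:*_; _:-_; :-_)
  open Sum semiring using (sum; sum-cong-≋; sum-remove; sum-replicate-zero; ∑-comm; *-distribˡ-sum)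
  open import Relation.Binary.Reasoning.Setoid setoid

  private p = suc q

  sum-single : ∀ {n} (i : Fin (suc n)) (f : Fin (suc n) → Carrier) →
    (∀ j → j ≢ i → f j ≈ 0#) → sum f ≈ f i
  sum-single {n} i f f≈0 = begin
    sum f                              ≈⟨ sum-remove {i = i} f ⟩
    f i + sum (f ∘ Fin.punchIn i)      ≈⟨ +-congˡ (sum-cong-≋ {n} λ j → f≈0 _ (Fin.punchInᵢ≢i i j)) ⟩
    f i + sum {n} (λ _ → 0#)           ≈⟨ +-congˡ (sum-replicate-zero n) ⟩
    f i + 0#                           ≈⟨ +-identityʳ _ ⟩
    f i                                ∎

  -- The coefficients of P(x)/(r - x), where P(x) = xᵖ - x + πv and P(r) = 0.
  quotientCoeff : Fin p → Carrier → Carrier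
  quotientCoeff Fin.zero    r = 1# - r ^ q
  quotientCoeff (Fin.suc β) r = - (r ^ (q ∸ suc (toℕ β)))

  -- As P(r) = 0, P(x) = (xᵖ - rᵖ) - (x - r) = (r - x)(1 - `cofactor p r x`).
  quotientCoeff-sum : ∀ x r → sum {p} (λ β → x ^ toℕ β * quotientCoeff β r) ≈ 1# - cofactor p r x
  quotientCoeff-sum x r = begin
    1# * (1# - r ^ q) + sum {q} (λ β → x * x ^ toℕ β * - (r ^ (q ∸ suc (toℕ β))))
      ≈⟨ +-congˡ (sum-cong-≋ {q} λ β → solve 3 (λ x a b → x :* a :* (:- b) := (:- x) :* (a :* b))
           ≈-refl x (x ^ toℕ β) (r ^ (q ∸ suc (toℕ β)))) ⟩
    1# * (1# - r ^ q) + sum {q} (λ β → - x * term β)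
      ≈⟨ +-congˡ (*-distribˡ-sum (- x) term) ⟨
    1# * (1# - r ^ q) + - x * sum {q} term
      ≈⟨ +-congˡ (*-congˡ (cofactor-sum q r x)) ⟨
    1# * (1# - r ^ q) + - x * cofactor q r x
      ≈⟨ solve 3 (λ w x c → con (+ 1) :* (con (+ 1) :- w) :+ (:- x) :* c
           := con (+ 1) :- (w :+ x :* c)) ≈-refl (r ^ q) x (cofactor q r x) ⟩
    1# - cofactor p r x ∎
    where
    term : Fin q → Carrier
    term β = x ^ toℕ β * r ^ (q ∸ suc (toℕ β))

  quotientCoeff-cong : ∀ β {r r′} → r ≈ r′ → quotientCoeff β r ≈ quotientCoeff β r′
  quotientCoeff-cong Fin.zero    e = +-congˡ (-‿cong (^-congˡ q e))
  quotientCoeff-cong (Fin.suc β) e = -‿cong (^-congˡ (q ∸ suc (toℕ β)) e)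

  analytic-quotientCoeff : ∀ β {f} → Analytic f → Analytic (λ u → quotientCoeff β (f u))
  analytic-quotientCoeff Fin.zero    a = analytic-+ (analytic-const 1#) (analytic-neg (analytic-^ a q))
  analytic-quotientCoeff (Fin.suc β) a = analytic-neg (analytic-^ a (q ∸ suc (toℕ β)))

  LevelAnalytic : ℕ → (Carrier → Carrier) → Set
  LevelAnalytic m f = ∀ a → Analytic (λ u → f (a + π ^ m * u))

  module _ (f : Carrier → Carrier) (f-cong : ∀ {x y} → x ≈ y → f x ≈ f y) where

    private
      weight : Carrier → Carrier
      weight r = [1+π - (r ^ q) ]⁻¹

      weight-cong : ∀ {r r′} → r ≈ r′ → weight r ≈ weight r′
      weight-cong e = inf-cong λ k → ^-congˡ k (-‿cong (-‿cong (^-congˡ q e)))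

      term : Fin p → Carrier → Carrier
      term β r = f r * weight r * quotientCoeff β r

      term-cong : ∀ β {r r′} → r ≈ r′ → term β r ≈ term β r′
      term-cong β e = *-cong (*-cong (f-cong e) (weight-cong e)) (quotientCoeff-cong β e)

    -- Lagrange interpolation at the roots of x = xᵖ + πv: the weight is the inverse of -P′(r).
    component : Fin p → Carrier → Carrier
    component β v = sum {p} (λ j → term β (r j v))

    component-cong : ∀ β {v v′} → v ≈ v′ → component β v ≈ component β v′
    component-cong β e = sum-cong-≋ {p} λ j → term-cong β (r-cong j e)

    private
      interpolation-at : ∀ x i → x ≈ r i (δ x) → f x ≈ sum {p} (λ β → x ^ toℕ β * component β (δ x))
      interpolation-at x i x≈rᵢ = ≈-sym (begin
        sum {p} (λ β → x ^ toℕ β * component β v)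
          ≈⟨ sum-cong-≋ {p} (λ β → *-distribˡ-sum {p} (x ^ toℕ β) (λ j → term β (r j v))) ⟩
        sum {p} (λ β → sum {p} (λ j → x ^ toℕ β * term β (r j v)))
          ≈⟨ ∑-comm {p} {p} (λ β j → x ^ toℕ β * term β (r j v)) ⟩
        sum {p} (λ j → sum {p} (λ β → x ^ toℕ β * term β (r j v)))
          ≈⟨ sum-cong-≋ {p} (λ j → begin
               sum {p} (λ β → x ^ toℕ β * term β (r j v))
                 ≈⟨ sum-cong-≋ {p} (λ β → solve 3 (λ a c b → a :* (c :* b) := c :* (a :* b)) ≈-refl
                      (x ^ toℕ β) (c j) (quotientCoeff β (r j v))) ⟩
               sum {p} (λ β → c j * (x ^ toℕ β * quotientCoeff β (r j v)))
                 ≈⟨ *-distribˡ-sum {p} (c j) (λ β → x ^ toℕ β * quotientCoeff β (r j v)) ⟨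
               c j * sum {p} (λ β → x ^ toℕ β * quotientCoeff β (r j v))
                 ≈⟨ *-congˡ (quotientCoeff-sum x (r j v)) ⟩
               c j * (1# - cofactor p (r j v) x) ∎) ⟩
        sum {p} (λ j → c j * (1# - cofactor p (r j v) x))
          -- With v = δx the point x is itself the root rᵢ(v), so the Lagrange polynomials of all
          -- other roots vanish at x.
          ≈⟨ sum-single i (λ j → c j * (1# - cofactor p (r j v) x)) (λ j j≢i → ≈-trans (*-congˡ (other j j≢i)) (zeroʳ _)) ⟩
        f ρ * weight ρ * (1# - cofactor p ρ x)
          ≈⟨ *-congˡ (+-congˡ (-‿cong (begin
               cofactor p ρ x      ≈⟨ cofactor-congˡ p x (≈-sym x≈rᵢ) ⟩
               cofactor p x x      ≈⟨ cofactor-diagonal q x ⟩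
               (p · 1#) * x ^ q    ≈⟨ *-cong (≈-sym π≈p·1) (^-congˡ q x≈rᵢ) ⟩
               π * ρ ^ q           ∎))) ⟩
        f ρ * weight ρ * (1# - π * ρ ^ q)
          ≈⟨ solve 4 (λ a w π y → a :* w :* (con (+ 1) :- π :* y)
               := a :* ((con (+ 1) :+ π :* (:- y)) :* w)) ≈-refl (f ρ) (weight ρ) π (ρ ^ q) ⟩
        f ρ * ((1# + π * - (ρ ^ q)) * weight ρ)
          ≈⟨ *-congˡ (*-inverse-1+π (- (ρ ^ q))) ⟩
        f ρ * 1#
          ≈⟨ ≈-trans (*-identityʳ _) (f-cong (≈-sym x≈rᵢ)) ⟩
        f x ∎)
        where
        v ρ : Carrier
        v = δ x
        ρ = r i v
        c : Fin p → Carrier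
        c j = f (r j v) * weight (r j v)
        -- Multiplied by x - s this is (x - xᵖ) - (s - sᵖ) = πv - πv = 0, and x - s is a unit.
        other : ∀ j → j ≢ i → 1# - cofactor p (r j v) x ≈ 0#
        other j j≢i = begin
          h                                       ≈⟨ *-identityˡ h ⟨
          1# * h                                  ≈⟨ *-congʳ inv ⟨
          (ρ - s) * w * h                         ≈⟨ *-congʳ (*-congʳ (+-congʳ (≈-sym x≈rᵢ))) ⟩
          (x - s) * w * (1# - cofactor p s x)
            ≈⟨ solve 4 (λ x s w k → (x :- s) :* w :* (con (+ 1) :- k)
                 := ((x :- s) :- (x :- s) :* k) :* w) ≈-refl x s w (cofactor p s x) ⟩
          ((x - s) - (x - s) * cofactor p s x) * w
            ≈⟨ *-congʳ (+-congʳ (+-cong (isRoot-δ x) (-‿cong (r-isRoot j v)))) ⟩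
          (((x ^ p + π * v) - (s ^ p + π * v)) - d) * w
            ≈⟨ *-congʳ (+-congʳ (+-congʳ (+-congʳ (^-cofactor p s x)))) ⟩
          ((((s ^ p + d) + π * v) - (s ^ p + π * v)) - d) * w
            ≈⟨ solve 4 (λ a d b w → (((a :+ d) :+ b) :- (a :+ b) :- d) :* w := con (+ 0)) ≈-refl
                 (s ^ p) d (π * v) w ⟩
          0# ∎
          where
          s h d w : Carrier
          s = r j v
          w = proj₁ (r-distinct v (j≢i ∘ ≡.sym))
          inv = proj₂ (r-distinct {i} {j} v (j≢i ∘ ≡.sym))
          h = 1# - cofactor p s x
          d = (x - s) * cofactor p s x

    interpolation : ∀ x → f x ≈ sum {p} (λ β → x ^ toℕ β * component β (δ x))
    interpolation x = interpolation-at x (proj₁ (r-surjective x)) (proj₂ (r-surjective x))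

    component-analytic : ∀ {m} → LevelAnalytic (suc m) f → ∀ β → LevelAnalytic m (component β)
    component-analytic {m} f-analytic β b = analytic-sum λ j → term-analytic j
      where
      term-analytic : ∀ j → Analytic (λ u → term β (r j (b + π ^ m * u)))
      term-analytic j = analytic-cong (λ u → term-cong β (r-increment u))
        (analytic-* (analytic-* (analytic-∘ (f-analytic (r j b)) s-analytic)
            (analytic-inf λ k → analytic-^ (analytic-neg (analytic-neg (analytic-^ ρ-analytic q))) k))
          (analytic-quotientCoeff β ρ-analytic))
        where
        -- Expanding the offset, not the root, to order πᵐ leaves one more `π` for the root: it
        -- stays in a ball of radius p⁻ᵐ⁻¹, on which f is analytic.
        increment = analytic-increment (Iteration.analytic-offset (toℕ j · 1#)) b (π ^ m)
        s = proj₁ increment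
        s-analytic = proj₁ (proj₂ increment)
        t-increment = proj₂ (proj₂ increment)
        r-increment : ∀ u → r j (b + π ^ m * u) ≈ r j b + π ^ suc m * s u
        r-increment u = ≈-trans (+-congˡ (*-congˡ (t-increment u)))
          (solve 5 (λ c π t w s → c :+ π :* (t :+ w :* s) := (c :+ π :* t) :+ (π :* w) :* s) ≈-refl
            (toℕ j · 1#) π (t j b) (π ^ m) (s u))
        ρ-analytic : Analytic (λ u → r j b + π ^ suc m * s u)
        ρ-analytic = analytic-+ (analytic-const (r j b)) (analytic-* (analytic-const (π ^ suc m)) s-analytic)

  -- Synthetic division by x - a: the remainder and the coefficients of the quotient.
  private
    horner : ∀ {n} → Vec Carrier n → Carrier → Carrier
    horner []       x = 0#
    horner (c ∷ cs) x = c + x * horner cs x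

    divide : ∀ {n} → Carrier → Vec Carrier (suc n) → Carrier × Vec Carrier n
    divide a (c ∷ [])     = c , []
    divide a (c ∷ d ∷ cs) = let (e , es) = divide a (d ∷ cs) in c + a * e , e ∷ es

    horner-divide : ∀ {n} a (cs : Vec Carrier (suc n)) x →
      horner cs x ≈ proj₁ (divide a cs) + (x - a) * horner (proj₂ (divide a cs)) x
    horner-divide a (c ∷ [])     x =
      solve 3 (λ a c x → c :+ x :* con (+ 0) := c :+ (x :- a) :* con (+ 0)) ≈-refl a c x
    horner-divide a (c ∷ d ∷ cs) x = ≈-trans (+-congˡ (*-congˡ (horner-divide a (d ∷ cs) x)))
      (solve 5 (λ a c x e h → c :+ x :* (e :+ (x :- a) :* h)
        := (c :+ a :* e) :+ (x :- a) :* (e :+ x :* h)) ≈-refl a c x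
        (proj₁ (divide a (d ∷ cs))) (horner (proj₂ (divide a (d ∷ cs))) x))

    Vanish : ∀ {n} → ℕ → Vec Carrier n → Set
    Vanish N cs = ∀ i → Vec.lookup cs i ≈ 0# mod N

    divide-vanish : ∀ {n N} a (cs : Vec Carrier (suc n)) →
      proj₁ (divide a cs) ≈ 0# mod N → Vanish N (proj₂ (divide a cs)) → Vanish N cs
    divide-vanish a (c ∷ [])     z zs Fin.zero    = z
    divide-vanish a (c ∷ d ∷ cs) z zs Fin.zero    = mod-trans
      (mod-≈ (solve 2 (λ c y → c := (c :+ y) :- y) ≈-refl c _))
      (mod-trans (mod-+ z (mod-neg (mod-* mod-refl (zs Fin.zero))))
        (mod-≈ (solve 1 (λ a → con (+ 0) :- a :* con (+ 0) := con (+ 0)) ≈-refl a)))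
    divide-vanish a (c ∷ d ∷ cs) z zs (Fin.suc i) =
      divide-vanish a (d ∷ cs) (zs Fin.zero) (zs ∘ Fin.suc) i

    -- There are zero divisors modulo `π ^ N`, so a root can be split off only because the other
    -- points differ from it by units: these remain zeros of the quotient, to which induction
    -- applies.
    horner-vanish : ∀ {n N} (cs : Vec Carrier n) (x : Fin n → Carrier) →
      (∀ {i j} → i ≢ j → ∃ λ w → (x i - x j) * w ≈ 1#) →
      (∀ i → horner cs (x i) ≈ 0# mod N) → Vanish N cs
    horner-vanish {suc n} {N} cs x distinct zero-at = divide-vanish a cs remainder≈0
      (horner-vanish quot (x ∘ Fin.suc) (λ i≢j → distinct (i≢j ∘ Fin.suc-injective)) λ i →
        let (w , inv) = distinct {Fin.suc i} {Fin.zero} λ ()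
            b = x (Fin.suc i)
            h = horner quot b
        in mod-trans (mod-≈ (begin
             h                                          ≈⟨ *-identityˡ h ⟨
             1# * h                                     ≈⟨ *-congʳ inv ⟨
             (b - a) * w * h                            ≈⟨ solve 4 (λ d w h e → d :* w :* h
                                                             := ((e :+ d :* h) :- e) :* w) ≈-refl (b - a) w h rem ⟩
             ((rem + (b - a) * h) - rem) * w            ≈⟨ *-congʳ (+-congʳ (horner-divide a cs b)) ⟨
             (horner cs b - rem) * w                    ∎))
           (mod-trans (mod-* (mod-+ (zero-at (Fin.suc i)) (mod-neg remainder≈0)) mod-refl)
             (mod-≈ (solve 1 (λ w → (con (+ 0) :- con (+ 0)) :* w := con (+ 0)) ≈-refl w))))
      where
      a = x Fin.zero
      rem = proj₁ (divide a cs)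
      quot = proj₂ (divide a cs)
      remainder≈0 : rem ≈ 0# mod N
      remainder≈0 = mod-trans (mod-≈ (≈-sym (≈-trans (horner-divide a cs a)
        (solve 3 (λ e a h → e :+ (a :- a) :* h := e) ≈-refl rem a (horner quot a))))) (zero-at Fin.zero)
    horner-vanish [] x distinct zero-at ()

    horner-sum : ∀ {n} (c : Fin n → Carrier) x →
      horner (Vec.tabulate c) x ≈ sum (λ β → x ^ toℕ β * c β)
    horner-sum {zero}  c x = ≈-refl
    horner-sum {suc n} c x = +-cong (≈-sym (*-identityˡ _))
      (≈-trans (*-congˡ (horner-sum (c ∘ Fin.suc) x))
        (≈-trans (*-distribˡ-sum x (λ β → x ^ toℕ β * c (Fin.suc β)))
          (sum-cong-≋ {n} λ β → ≈-sym (*-assoc x _ _))))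

  -- A Vandermonde system with unit determinant. It is stated modulo `π ^ N` because it is applied
  -- to truncations, which vanish only to finite precision.
  coefficients-vanish : ∀ {n N} (c : Fin n → Carrier) (x : Fin n → Carrier) →
    (∀ {i j} → i ≢ j → ∃ λ w → (x i - x j) * w ≈ 1#) →
    (∀ i → sum (λ β → x i ^ toℕ β * c β) ≈ 0# mod N) → ∀ β → c β ≈ 0# mod N
  coefficients-vanish {N = N} c x distinct zero-at β =
    subst (λ y → y ≈ 0# mod N) (Vec.lookup∘tabulate c β)
      (horner-vanish (Vec.tabulate c) x distinct
        (λ i → mod-trans (mod-≈ (horner-sum c (x i))) (zero-at i)) β)

-- Existence and uniqueness of the expansion along jets

module JetExpansion {q : ℕ} (A : AdicRing q) where

  open AdicRing A
  open AdicCongruence A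
  open AnalyticFunctions A
  open Roots A
  open Interpolation A
  open IntegerSolver commutativeRing using (solve; con; _:=_; _:+_; _:*_; _:-_; :-_)
  open Sum semiring using (sum; sum-cong-≋; sum-replicate-zero; ∑-distrib-+; *-distribˡ-sum)
  open import Relation.Binary.Reasoning.Setoid setoid

  private p = suc q

  Series : ℕ → Set
  Series k = Vec ℕ k → Carrier

  Restricted : ∀ {k} → Series k → Set
  Restricted F = ∀ N → ∃ λ M → ∀ α → M ≤ Vec.sum α → F α ≈ 0# mod N

  Reduced : ∀ {m} → Series (suc m) → Set
  Reduced F = ∀ α → ¬ (∀ i → Vec.lookup (Vec.init α) i ≤ q) → F α ≈ 0#

  slice : ∀ {k} → Series (suc k) → ℕ → Series k
  slice F i α = F (i ∷ α)

  -- The sum of F(α)xᵅ over |α| ≤ n.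
  truncation : ∀ {k} → Series k → Vec Carrier k → ℕ → Carrier
  truncation F []      n = F []
  truncation F (x ∷ y) n = sum {suc n} (λ i → x ^ toℕ i * truncation (slice F (toℕ i)) y (n ∸ toℕ i))

  infix 4 _⟦_⟧⟶_

  _⟦_⟧⟶_ : ∀ {k} → Series k → Vec Carrier k → Carrier → Set
  F ⟦ x ⟧⟶ y = ∀ N → ∃ λ M → ∀ n → M ≤ n → truncation F x n ≈ y mod N

  jet : ∀ m → Carrier → Vec Carrier (suc m)
  jet m a = Vec.iterate δ a (suc m)

  truncation-cong : ∀ {k} {F G : Series k} {x y} → (∀ α → F α ≈ G α) → Pointwise _≈_ x y →
    ∀ n → truncation F x n ≈ truncation G y n
  truncation-cong F≈G []        n = F≈G []
  truncation-cong F≈G (e ∷ es) n = sum-cong-≋ {suc n} λ i →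
    *-cong (^-congˡ (toℕ i) e) (truncation-cong (λ α → F≈G (toℕ i ∷ α)) es (n ∸ toℕ i))

  ≈ᵛ-refl : ∀ {k} {x : Vec Carrier k} → Pointwise _≈_ x x
  ≈ᵛ-refl {x = []}    = []
  ≈ᵛ-refl {x = _ ∷ _} = ≈-refl ∷ ≈ᵛ-refl

  δ-cong : ∀ {a b} → a ≈ b → δ a ≈ δ b
  δ-cong {a} {b} e = isRoot⇒δ (≈-trans e (≈-trans (isRoot-δ b) (+-congʳ (^-congˡ p (≈-sym e)))))

  iterate-cong : ∀ n {a b} → a ≈ b → Pointwise _≈_ (Vec.iterate δ a n) (Vec.iterate δ b n)
  iterate-cong zero    e = []
  iterate-cong (suc n) e = e ∷ iterate-cong n (δ-cong e)

  truncation-zero : ∀ {k} {F : Series k} x n → (∀ α → F α ≈ 0#) → truncation F x n ≈ 0#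
  truncation-zero []      n F≈0 = F≈0 []
  truncation-zero (x ∷ y) n F≈0 = ≈-trans
    (sum-cong-≋ {suc n} λ i → ≈-trans
      (*-congˡ (truncation-zero y (n ∸ toℕ i) (λ α → F≈0 (toℕ i ∷ α)))) (zeroʳ (x ^ toℕ i)))
    (sum-replicate-zero (suc n))

  sum-truncate-mod : ∀ {N m n} (f : ℕ → Carrier) → m ≤ n → (∀ k → m ≤ k → f k ≈ 0# mod N) →
    sum {n} (f ∘ toℕ) ≈ sum {m} (f ∘ toℕ) mod N
  sum-truncate-mod {n = n} f z≤n f≈0 =
    mod-trans (mod-sum {k = n} λ i → f≈0 (toℕ i) z≤n) (mod-≈ (sum-replicate-zero n))
  sum-truncate-mod f (s≤s m≤n) f≈0 =
    mod-+ mod-refl (sum-truncate-mod (f ∘ suc) m≤n (λ k m≤k → f≈0 (suc k) (s≤s m≤k)))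

  sum-truncate : ∀ {m n} (f : ℕ → Carrier) → m ≤ n → (∀ k → m ≤ k → f k ≈ 0#) →
    sum {n} (f ∘ toℕ) ≈ sum {m} (f ∘ toℕ)
  sum-truncate {m} {n} f m≤n f≈0 =
    mod-separated λ N → sum-truncate-mod {N} {m} {n} f m≤n λ k m≤k → mod-≈ (f≈0 k m≤k)

  -- Puts a truncation into the shape of a polynomial of degree less than p in the first variable,
  -- as interpolation produces it and `coefficients-vanish` consumes it. The slice at β is left with
  -- total degree n - β.
  truncation-sum : ∀ {k} (F : Series (suc k)) x y {n} → q ≤ n → (∀ i α → p ≤ i → F (i ∷ α) ≈ 0#) →
    truncation F (x ∷ y) n ≈ sum {p} (λ β → x ^ toℕ β * truncation (slice F (toℕ β)) y (n ∸ toℕ β))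
  truncation-sum F x y {n} q≤n F≈0 = sum-truncate
    (λ i → x ^ i * truncation (slice F i) y (n ∸ i)) (s≤s q≤n)
    (λ i p≤i → ≈-trans (*-congˡ (truncation-zero y (n ∸ i) (λ α → F≈0 i α p≤i))) (zeroʳ _))

  supremum : ∀ {n} → (Fin n → ℕ) → ℕ
  supremum {zero}  f = 0
  supremum {suc n} f = f Fin.zero ℕ.⊔ supremum (f ∘ Fin.suc)

  ≤supremum : ∀ {n} (f : Fin n → ℕ) i → f i ≤ supremum f
  ≤supremum f Fin.zero    = ℕ.m≤m⊔n (f Fin.zero) _
  ≤supremum f (Fin.suc i) = ℕ.≤-trans (≤supremum (f ∘ Fin.suc) i) (ℕ.m≤n⊔m (f Fin.zero) _)

  coeff : Poly → ℕ → Carrier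
  coeff []      n       = 0#
  coeff (c ∷ P) zero    = c
  coeff (c ∷ P) (suc n) = coeff P n

  coeff≈0 : ∀ P {n} → List.length P ≤ n → coeff P n ≈ 0#
  coeff≈0 []      _         = ≈-refl
  coeff≈0 (c ∷ P) (s≤s l≤n) = coeff≈0 P l≤n

  eval-coeff : ∀ P u {n} → List.length P ≤ n → sum {n} (λ i → u ^ toℕ i * coeff P (toℕ i)) ≈ eval P u
  eval-coeff [] u {n} _ = ≈-trans (sum-cong-≋ {n} λ i → zeroʳ (u ^ toℕ i)) (sum-replicate-zero n)
  eval-coeff (c ∷ P) u {suc n} (s≤s l≤n) = +-cong (*-identityˡ c)
    (≈-trans (≈-trans (sum-cong-≋ {n} λ i → *-assoc u _ _)
        (≈-sym (*-distribˡ-sum {n} u (λ i → u ^ toℕ i * coeff P (toℕ i)))))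
      (*-congˡ (eval-coeff P u l≤n)))

  private
    degreeBound : (ℕ → Poly) → ℕ → ℕ
    degreeBound P zero    = 0
    degreeBound P (suc N) = List.length (P 0) ℕ.⊔ degreeBound (P ∘ suc) N

    psum-coeff≈0 : ∀ P N {n} → degreeBound P N ≤ n → psum (λ k → coeff (P k) n) N ≈ 0#
    psum-coeff≈0 P zero    _ = ≈-refl
    psum-coeff≈0 P (suc N) b = ≈-trans
      (+-cong (coeff≈0 (P 0) (ℕ.m⊔n≤o⇒m≤o _ _ b))
        (*-congˡ (psum-coeff≈0 (P ∘ suc) N (ℕ.m⊔n≤o⇒n≤o (List.length (P 0)) _ b))))
      (solve 1 (λ π → con (+ 0) :+ π :* con (+ 0) := con (+ 0)) ≈-refl π)

    sum-psum-coeff : ∀ P N u {n} → degreeBound P N ≤ n →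
      sum {n} (λ i → u ^ toℕ i * psum (λ k → coeff (P k) (toℕ i)) N) ≈ psum (λ k → eval (P k) u) N
    sum-psum-coeff P zero    u {n} _ =
      ≈-trans (sum-cong-≋ {n} λ i → zeroʳ (u ^ toℕ i)) (sum-replicate-zero n)
    sum-psum-coeff P (suc N) u {n} b = begin
      sum {n} (λ i → u ^ toℕ i * (c i + π * s i))
        ≈⟨ sum-cong-≋ {n} (λ i → solve 4 (λ w c π s → w :* (c :+ π :* s) := w :* c :+ π :* (w :* s))
             ≈-refl (u ^ toℕ i) (c i) π (s i)) ⟩
      sum {n} (λ i → u ^ toℕ i * c i + π * (u ^ toℕ i * s i))
        ≈⟨ ∑-distrib-+ {n} (λ i → u ^ toℕ i * c i) (λ i → π * (u ^ toℕ i * s i)) ⟩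
      sum {n} (λ i → u ^ toℕ i * c i) + sum {n} (λ i → π * (u ^ toℕ i * s i))
        ≈⟨ +-cong (eval-coeff (P 0) u (ℕ.m⊔n≤o⇒m≤o _ _ b))
             (≈-trans (≈-sym (*-distribˡ-sum {n} π (λ i → u ^ toℕ i * s i)))
               (*-congˡ (sum-psum-coeff (P ∘ suc) N u (ℕ.m⊔n≤o⇒n≤o (List.length (P 0)) _ b)))) ⟩
      eval (P 0) u + π * psum (λ k → eval (P (suc k)) u) N ∎
      where
      c s : Fin n → Carrier
      c i = coeff (P 0) (toℕ i)
      s i = psum (λ k → coeff (P (suc k)) (toℕ i)) N

  -- The way back from digits to coefficients: the coefficient of uⁿ is gathered from all the
  -- polynomials.
  series : (ℕ → Poly) → Series 1
  series P (n ∷ []) = inf (λ k → coeff (P k) n)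

  -- Modulo `π ^ N` only the first N polynomials contribute, and their degrees are bounded.
  series-restricted : ∀ P → Restricted (series P)
  series-restricted P N = degreeBound P N , λ { (n ∷ []) b → mod-trans (inf-psum _ N)
    (mod-≈ (psum-coeff≈0 P N (subst (degreeBound P N ≤_) (ℕ.+-identityʳ n) b))) }

  series-value : ∀ P u → series P ⟦ u ∷ [] ⟧⟶ inf (λ k → eval (P k) u)
  series-value P u N = degreeBound P N , λ n b → mod-trans
    (mod-sum {k = suc n} λ i → mod-* (mod-refl {x = u ^ toℕ i}) (inf-psum (λ k → coeff (P k) (toℕ i)) N))
    (mod-trans (mod-≈ (sum-psum-coeff P N u (ℕ.m≤n⇒m≤1+n b))) (mod-sym (inf-psum _ N)))

  private
    at : ∀ {n} → (Fin n → Carrier) → ℕ → Carrier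
    at {zero}  g i       = 0#
    at {suc n} g zero    = g Fin.zero
    at {suc n} g (suc i) = at (g ∘ Fin.suc) i

    at-toℕ : ∀ {n} (g : Fin n → Carrier) β → at g (toℕ β) ≡ g β
    at-toℕ g Fin.zero    = refl
    at-toℕ g (Fin.suc β) = at-toℕ (g ∘ Fin.suc) β

    at-≥ : ∀ {n i} (g : Fin n → Carrier) → n ≤ i → at g i ≡ 0#
    at-≥ g z≤n       = refl
    at-≥ g (s≤s n≤i) = at-≥ (g ∘ Fin.suc) n≤i

    at-elim : ∀ {n} i (P : Carrier → Set) {g : Fin n → Carrier} →
      P 0# → (∀ β → toℕ β ≡ i → P (g β)) → P (at g i)
    at-elim {zero}  i       P P0 Pg = P0
    at-elim {suc n} zero    P P0 Pg = Pg Fin.zero refl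
    at-elim {suc n} (suc i) P P0 Pg = at-elim i P P0 λ β e → Pg (Fin.suc β) (cong suc e)

  -- The series Σ x^β G_β over β < p; the default value of `at` makes all higher powers of x absent.
  join : ∀ {k} → (Fin p → Series k) → Series (suc k)
  join G (i ∷ α) = at (λ β → G β α) i

  -- The first exponent of a nonzero term is below p, so a total degree of at least M + p leaves at
  -- least M for the other variables.
  join-restricted : ∀ {k} (G : Fin p → Series k) → (∀ β → Restricted (G β)) → Restricted (join G)
  join-restricted G G-restricted N = supremum M ℕ.+ p , bound
    where
    M : Fin p → ℕ
    M β = proj₁ (G-restricted β N)
    bound : ∀ α → supremum M ℕ.+ p ≤ Vec.sum α → join G α ≈ 0# mod N
    bound (i ∷ α) b = at-elim i (λ c → c ≈ 0# mod N) mod-refl λ β βi →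
      proj₂ (G-restricted β N) α (ℕ.≤-trans (≤supremum M β) (ℕ.+-cancelˡ-≤ p _ _
        (ℕ.≤-trans (subst (_≤ i ℕ.+ Vec.sum α) (ℕ.+-comm (supremum M) p) b)
          (ℕ.+-monoˡ-≤ (Vec.sum α) (subst (_≤ p) βi (ℕ.<⇒≤ (Fin.toℕ<n β)))))))

  join-reduced : ∀ {m} (G : Fin p → Series (suc m)) → (∀ β → Reduced (G β)) → Reduced (join G)
  join-reduced G G-reduced (i ∷ α) ¬I = at-elim i (_≈ 0#) ≈-refl λ β βi →
    G-reduced β α λ I → ¬I λ
      { Fin.zero    → subst (_≤ q) βi (ℕ.≤-pred (Fin.toℕ<n β))
      ; (Fin.suc j) → I j }

  -- Adding p to the common threshold keeps n - β beyond the threshold of every slice.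
  join-value : ∀ {k} (G : Fin p → Series k) x y (g : Fin p → Carrier) → (∀ β → G β ⟦ y ⟧⟶ g β) →
    join G ⟦ x ∷ y ⟧⟶ sum {p} (λ β → x ^ toℕ β * g β)
  join-value G x y g G→g N = supremum M ℕ.+ p , λ n b → mod-trans
    (mod-≈ (truncation-sum (join G) x y (ℕ.≤-trans (ℕ.n≤1+n q) (ℕ.m+n≤o⇒n≤o (supremum M) b))
      λ i α p≤i → reflexive (at-≥ (λ β → G β α) p≤i)))
    (mod-sum {k = p} λ β → mod-* (mod-refl {x = x ^ toℕ β}) (mod-trans
      (mod-≈ (truncation-cong (λ α → reflexive (at-toℕ (λ β → G β α) β)) (≈ᵛ-refl {x = y}) (n ∸ toℕ β)))
      (proj₂ (G→g β N) (n ∸ toℕ β) (ℕ.≤-trans (≤supremum M β) (ℕ.m+n≤o⇒m≤o∸n (supremum M)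
        (ℕ.≤-trans (ℕ.+-monoʳ-≤ (supremum M) (ℕ.<⇒≤ (Fin.toℕ<n β))) b))))))
    where
    M : Fin p → ℕ
    M β = proj₁ (G→g β N)

  value-resp : ∀ {k} (F : Series k) x {y z} → y ≈ z → F ⟦ x ⟧⟶ y → F ⟦ x ⟧⟶ z
  value-resp F x e F→y N = let (M , h) = F→y N in M , λ n b → mod-trans (h n b) (mod-≈ e)

  existence : ∀ m f → (∀ {x y} → x ≈ y → f x ≈ f y) → LevelAnalytic m f →
    ∃ λ (F : Series (suc m)) → Restricted F × Reduced F × (∀ a → F ⟦ jet m a ⟧⟶ f a)
  -- At level 0 the expansion about 0 is valid on the whole ring, since π⁰ = 1.
  existence zero f f-cong f-analytic =
    series P , series-restricted P , (λ { (n ∷ []) ¬I → contradiction (λ ()) ¬I }) ,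
    λ a → value-resp (series P) (a ∷ []) (≈-trans (≈-sym (expand (f-analytic 0#) a))
      (f-cong (solve 1 (λ a → con (+ 0) :+ con (+ 1) :* a := a) ≈-refl a))) (series-value P a)
    where
    P : ℕ → Poly
    P = digits (f-analytic 0#)
  existence (suc m) f f-cong f-analytic =
    join G , join-restricted G (λ β → proj₁ (proj₂ (ih β))) ,
    join-reduced G (λ β → proj₁ (proj₂ (proj₂ (ih β)))) ,
    λ a → value-resp (join G) (jet (suc m) a) (≈-sym (interpolation f f-cong a))
      (join-value G a (jet m (δ a)) (λ β → component f f-cong β (δ a))
        λ β → proj₂ (proj₂ (proj₂ (ih β))) (δ a))
    where
    ih = λ β → existence m (component f f-cong β) (component-cong f f-cong β)
                 (component-analytic f f-cong {m} f-analytic β)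
    G : Fin p → Series (suc m)
    G β = proj₁ (ih β)

  private
    -- Evaluate at πᵏ for all k: the value is congruent to c₀ mod πᵏ, and dividing the rest by πᵏ
    -- leaves a series of the same kind.
    coefficient≈0 : ∀ n (c : ℕ → Carrier) →
      (∀ k N → ∃ λ M → ∀ n → M ≤ n → sum {suc n} (λ i → (π ^ k) ^ toℕ i * c (toℕ i)) ≈ 0# mod N) →
      c n ≈ 0#
    coefficient≈0 n c c→0 = go n
      where
      rest : ℕ → ℕ → Carrier
      rest k n = sum {n} (λ i → (π ^ k) ^ toℕ i * c (suc (toℕ i)))
      split : ∀ k n → sum {suc n} (λ i → (π ^ k) ^ toℕ i * c (toℕ i)) ≈ c 0 + π ^ k * rest k n
      split k n = +-cong (*-identityˡ _) (≈-trans (sum-cong-≋ {n} λ i → *-assoc (π ^ k) _ _)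
        (≈-sym (*-distribˡ-sum {n} (π ^ k) (λ i → (π ^ k) ^ toℕ i * c (suc (toℕ i))))))
      c₀≈0 : c 0 ≈ 0#
      c₀≈0 = mod-separated λ k → let (M , h) = c→0 k k in
        mod-trans (mod-sym (congruent (rest k M) (split k M))) (h M ℕ.≤-refl)
      go : ∀ n → c n ≈ 0#
      go zero    = c₀≈0
      -- Dividing by πᵏ costs k digits, so the hypothesis is used to precision k + N.
      go (suc n) = coefficient≈0 n (c ∘ suc) λ k N → let (M , h) = c→0 k (k ℕ.+ N) in
        M , λ n b → mod-π^ k (mod-trans
          (mod-≈ (≈-sym (≈-trans (split k (suc n)) (≈-trans (+-congʳ c₀≈0) (+-identityˡ _)))))
          (h (suc n) (ℕ.m≤n⇒m≤1+n b)))

  reduced-≥p : ∀ {m} (F : Series (suc (suc m))) → Reduced F → ∀ i α → p ≤ i → F (i ∷ α) ≈ 0#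
  reduced-≥p F F-reduced i α p≤i = F-reduced (i ∷ α) λ I → ℕ.<⇒≱ p≤i (I Fin.zero)

  uniqueness : ∀ m (D : Series (suc m)) → Reduced D → (∀ a → D ⟦ jet m a ⟧⟶ 0#) → ∀ α → D α ≈ 0#
  uniqueness zero    D D-reduced D→0 (n ∷ []) =
    coefficient≈0 n (λ i → D (i ∷ [])) (λ k → D→0 (π ^ k))
  uniqueness (suc m) D D-reduced D→0 (i ∷ α) with i ℕ.<? p
  ... | no  i≮p = reduced-≥p D D-reduced i α (ℕ.≮⇒≥ i≮p)
  ... | yes i<p = subst (λ i → D (i ∷ α) ≈ 0#) (Fin.toℕ-fromℕ< i<p)
    (uniqueness m (slice D (toℕ β₀)) (slice-reduced β₀) (slice→0 β₀) α)
    where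
    β₀ = Fin.fromℕ< i<p
    slice-reduced : ∀ (β : Fin p) → Reduced (slice D (toℕ β))
    slice-reduced β α ¬I = D-reduced (toℕ β ∷ α) λ I → ¬I (I ∘ Fin.suc)
    slice→0 : ∀ (β : Fin p) v → slice D (toℕ β) ⟦ jet m v ⟧⟶ 0#
    -- The p linear conditions need one common order of truncation, hence the supremum; adding q
    -- makes room for every exponent below p. Truncating the slice at n corresponds to truncating
    -- `D` at n + β.
    slice→0 β v N = supremum M ℕ.+ q , λ n b → subst (λ k → truncation (slice D (toℕ β)) (jet m v) k ≈ 0# mod N)
      (ℕ.m+n∸n≡m n (toℕ β)) (vanish (n ℕ.+ toℕ β) (ℕ.m≤n⇒m≤n+o (toℕ β) b))
      where
      M : Fin p → ℕ
      M j = proj₁ (D→0 (r j v) N)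
      vanish : ∀ n → supremum M ℕ.+ q ≤ n →
        truncation (slice D (toℕ β)) (jet m v) (n ∸ toℕ β) ≈ 0# mod N
      vanish n b = coefficients-vanish {p} {N}
        (λ β → truncation (slice D (toℕ β)) (jet m v) (n ∸ toℕ β)) (λ j → r j v) (r-distinct v)
        (λ j → mod-trans (mod-≈ (≈-trans
            (≈-sym (truncation-sum D (r j v) (jet m v) (ℕ.m+n≤o⇒n≤o (supremum M) b) (reduced-≥p D D-reduced)))
            -- δ(rⱼ(v)) = v, so the jet of rⱼ(v) is rⱼ(v) followed by the jet of v.
            (truncation-cong {F = D} {G = D} (λ _ → ≈-refl)
              (≈-refl ∷ iterate-cong (suc m) (≈-sym (isRoot⇒δ (r-isRoot j v)))) n)))
          (proj₂ (D→0 (r j v) N) n (ℕ.≤-trans (≤supremum M j) (ℕ.m+n≤o⇒m≤o (supremum M) b))))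
        β

-- From coefficients and partial sums to digits and truncations

module PowerSeriesValues {q : ℕ} (A : AdicRing q) where

  open AdicRing A
  open AdicCongruence A
  open AnalyticFunctions A
  open Interpolation A using (LevelAnalytic)
  open JetExpansion A
  open IntegerSolver commutativeRing using (solve; con; _:=_; _:+_; _:*_; _:-_; :-_)
  open Sum semiring using (sum; sum-cong-≋; ∑-distrib-+; *-distribˡ-sum)
  open import Relation.Binary.Reasoning.Setoid setoid

  private
    ofCoeffs : (ℕ → Carrier) → ℕ → Poly
    ofCoeffs g zero    = []
    ofCoeffs g (suc n) = g 0 ∷ ofCoeffs (g ∘ suc) n

    eval-ofCoeffs : ∀ g n u → eval (ofCoeffs g n) u ≈ sum {n} (λ i → u ^ toℕ i * g (toℕ i))
    eval-ofCoeffs g zero    u = ≈-refl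
    eval-ofCoeffs g (suc n) u = +-cong (≈-sym (*-identityˡ _))
      (≈-trans (*-congˡ (eval-ofCoeffs (g ∘ suc) n u))
        (≈-trans (*-distribˡ-sum {n} u (λ i → u ^ toℕ i * g (suc (toℕ i))))
          (sum-cong-≋ {n} λ i → ≈-sym (*-assoc u _ _))))

    from : ℕ → (ℕ → Carrier) → ℕ → Carrier
    from zero    h i       = h i
    from (suc m) h zero    = 0#
    from (suc m) h (suc i) = from m (h ∘ suc) i

    from-≥ : ∀ {m i} h → m ≤ i → from m h i ≡ h i
    from-≥ h z≤n       = refl
    from-≥ h (s≤s m≤i) = from-≥ (h ∘ suc) m≤i

    from-< : ∀ {m i} h → i < m → from m h i ≡ 0#
    from-< {suc m} {zero}  h _         = refl
    from-< {suc m} {suc i} h (s≤s i<m) = from-< (h ∘ suc) i<m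

    sum-split : ∀ {m n} h → m ≤ n →
      sum {n} (h ∘ toℕ) ≈ sum {m} (h ∘ toℕ) + sum {n} (λ i → from m h (toℕ i))
    sum-split h z≤n = ≈-sym (+-identityˡ _)
    sum-split {suc m} {suc n} h (s≤s m≤n) = ≈-trans (+-congˡ (sum-split (h ∘ suc) m≤n))
      (solve 3 (λ a b c → a :+ (b :+ c) := (a :+ b) :+ (con (+ 0) :+ c)) ≈-refl _ _ _)

  -- The k-th digit collects the monomials whose coefficients are divisible by πᵏ by virtue of their
  -- degree, but were not collected before.
  restricted⇒analytic : ∀ (F : Series 1) {f} → Restricted F → (∀ u → F ⟦ u ∷ [] ⟧⟶ f u) → Analytic f
  restricted⇒analytic F {f} F-restricted F→f = analytic P λ u → mod-separated λ N →
    let (M , h) = F→f u N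
        n = M ℕ.⊔ B N
    in mod-trans (mod-sym (h n (ℕ.m≤m⊔n M (B N))))
         (mod-trans (sum-truncate-mod (λ i → u ^ i * c i) (ℕ.m≤n⇒m≤1+n (ℕ.m≤n⊔m M (B N)))
             λ i b → mod-trans (mod-* mod-refl (c≈0 N i b)) (mod-≈ (zeroʳ (u ^ i))))
           (mod-trans (mod-≈ (≈-sym (psum-P u N))) (mod-sym (inf-psum _ N))))
    where
    c : ℕ → Carrier
    c i = F (i ∷ [])
    B : ℕ → ℕ
    B zero    = 0
    -- The maximum makes `B` monotone, so the index ranges from `B k` up to `B (suc k)` are disjoint
    -- and adjacent.
    B (suc k) = B k ℕ.⊔ proj₁ (F-restricted (suc k))
    c≈0 : ∀ k i → B k ≤ i → c i ≈ 0# mod k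
    c≈0 zero    i b = mod-zero
    c≈0 (suc k) i b = proj₂ (F-restricted (suc k)) (i ∷ [])
      (subst (_ ≤_) (≡.sym (ℕ.+-identityʳ i)) (ℕ.m⊔n≤o⇒n≤o (B k) _ b))
    quotient : ∀ k i → ∃ λ g → π ^ k * g ≈ from (B k) c i
    quotient k i with B k ℕ.≤? i
    ... | yes b = quot , ≈-sym (≈-trans (reflexive (from-≥ c b)) (≈-trans equation (+-identityˡ _)))
      where open _≈_mod_ (c≈0 k i b)
    ... | no ¬b = 0# , ≈-trans (zeroʳ _) (reflexive (≡.sym (from-< c (ℕ.≰⇒> ¬b))))
    P : ℕ → Poly
    P k = ofCoeffs (λ i → proj₁ (quotient k i)) (B (suc k))
    from-* : ∀ u m i h → u ^ i * from m h i ≈ from m (λ i → u ^ i * h i) i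
    from-* u m i h with m ℕ.≤? i
    ... | yes b = ≈-trans (*-congˡ (reflexive (from-≥ h b))) (reflexive (≡.sym (from-≥ _ b)))
    ... | no ¬b = ≈-trans (*-congˡ (reflexive (from-< h (ℕ.≰⇒> ¬b))))
      (≈-trans (zeroʳ _) (reflexive (≡.sym (from-< _ (ℕ.≰⇒> ¬b)))))
    psum-P : ∀ u N → psum (λ k → eval (P k) u) N ≈ sum {B N} (λ i → u ^ toℕ i * c (toℕ i))
    psum-P u zero    = ≈-refl
    psum-P u (suc N) = begin
      psum (λ k → eval (P k) u) (suc N)
        ≈⟨ psum-suc _ N ⟩
      psum (λ k → eval (P k) u) N + π ^ N * eval (P N) u
        ≈⟨ +-cong (psum-P u N) (*-congˡ (eval-ofCoeffs (λ i → proj₁ (quotient N i)) (B (suc N)) u)) ⟩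
      S + π ^ N * sum {B (suc N)} (λ i → u ^ toℕ i * proj₁ (quotient N (toℕ i)))
        ≈⟨ +-congˡ (*-distribˡ-sum {B (suc N)} (π ^ N) (λ i → u ^ toℕ i * proj₁ (quotient N (toℕ i)))) ⟩
      S + sum {B (suc N)} (λ i → π ^ N * (u ^ toℕ i * proj₁ (quotient N (toℕ i))))
        ≈⟨ +-congˡ (sum-cong-≋ {B (suc N)} λ i → ≈-trans
             (solve 3 (λ a b c → a :* (b :* c) := b :* (a :* c)) ≈-refl (π ^ N) (u ^ toℕ i) _)
             (≈-trans (*-congˡ (proj₂ (quotient N (toℕ i)))) (from-* u (B N) (toℕ i) c))) ⟩
      S + sum {B (suc N)} (λ i → from (B N) (λ i → u ^ i * c i) (toℕ i))
        ≈⟨ sum-split {B N} {B (suc N)} (λ i → u ^ i * c i) (ℕ.m≤m⊔n (B N) _) ⟨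
      sum {B (suc N)} (λ i → u ^ toℕ i * c (toℕ i)) ∎
      where S = sum {B N} (λ i → u ^ toℕ i * c (toℕ i))

  truncation-+ : ∀ {k} (F G : Series k) x n →
    truncation (λ α → F α + G α) x n ≈ truncation F x n + truncation G x n
  truncation-+ F G []      n = ≈-refl
  truncation-+ F G (x ∷ y) n = ≈-trans
    (sum-cong-≋ {suc n} λ i → ≈-trans
      (*-congˡ (truncation-+ (slice F (toℕ i)) (slice G (toℕ i)) y (n ∸ toℕ i)))
      (distribˡ (x ^ toℕ i) _ _))
    (∑-distrib-+ {suc n} (λ i → x ^ toℕ i * truncation (slice F (toℕ i)) y (n ∸ toℕ i))
      (λ i → x ^ toℕ i * truncation (slice G (toℕ i)) y (n ∸ toℕ i)))

  value-difference : ∀ {k} (F G : Series k) x {y} → F ⟦ x ⟧⟶ y → G ⟦ x ⟧⟶ y →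
    (λ α → F α - G α) ⟦ x ⟧⟶ 0#
  value-difference F G x {y} F→y G→y N =
    let (M , f) = F→y N
        (L , g) = G→y N
    in M ℕ.⊔ L , λ n b → mod-trans (mod-≈ (difference n))
         (mod-trans (mod-+ (f n (ℕ.m⊔n≤o⇒m≤o M L b)) (mod-neg (g n (ℕ.m⊔n≤o⇒n≤o M L b))))
           (mod-≈ (-‿inverseʳ y)))
    where
    D : Series _
    D α = F α - G α
    difference : ∀ n → truncation D x n ≈ truncation F x n - truncation G x n
    difference n = begin
      d                              ≈⟨ solve 2 (λ d g → d := (d :+ g) :- g) ≈-refl d g ⟩
      (d + g) - g                    ≈⟨ +-congʳ (truncation-+ D G x n) ⟨
      truncation (λ α → D α + G α) x n - g
        ≈⟨ +-congʳ (truncation-cong (λ α → solve 2 (λ a b → (a :- b) :+ b := a) ≈-refl (F α) (G α))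
             (≈ᵛ-refl {x = x}) n) ⟩
      truncation F x n - g           ∎
      where
      d g : Carrier
      d = truncation D x n
      g = truncation G x n

  -- This and the next three lemmas translate between congruences and divisibility witnesses, which
  -- carry the quotient on the left.
  quot-difference : ∀ {n} x y (h : x ≈ y mod n) → _≈_mod_.quot h * π ^ n ≈ x - y
  quot-difference {n} x y (congruent k e) = begin
    k * π ^ n              ≈⟨ solve 3 (λ y w k → k :* w := (y :+ w :* k) :- y) ≈-refl y (π ^ n) k ⟩
    (y + π ^ n * k) - y    ≈⟨ +-congʳ e ⟨
    x - y                  ∎

  congruent-difference : ∀ {n} x y k → k * π ^ n ≈ x - y → x ≈ y mod n
  congruent-difference {n} x y k e = congruent k (begin
    x               ≈⟨ solve 2 (λ x y → x := y :+ (x :- y)) ≈-refl x y ⟩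
    y + (x - y)     ≈⟨ +-congˡ (≈-trans (≈-sym e) (*-comm k (π ^ n))) ⟩
    y + π ^ n * k   ∎)

  quot-zero : ∀ {n} x (h : x ≈ 0# mod n) → _≈_mod_.quot h * π ^ n ≈ x
  quot-zero {n} x (congruent k e) = ≈-trans (*-comm k (π ^ n)) (≈-sym (≈-trans e (+-identityˡ _)))

  congruent-zero : ∀ {n} x k → k * π ^ n ≈ x → x ≈ 0# mod n
  congruent-zero {n} x k e = congruent k (≈-sym (≈-trans (+-identityˡ _) (≈-trans (*-comm (π ^ n) k) e)))

  -- Repeats over the abstract ring the shape of the monomials in ℤₚ, so that the two agree by
  -- `refl`.
  monomial : ∀ {k} → Vec Carrier k → Vec ℕ k → Carrier
  monomial x α = Vec.foldr′ _*_ 1# (Vec.zipWith _^_ x α)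

  sumOver : ∀ {k} → Series k → Vec Carrier k → List (Vec ℕ k) → Carrier
  sumOver F x L = List.foldr _+_ 0# (List.map (λ α → F α * monomial x α) L)

  sumOver-++ : ∀ {k} (F : Series k) x L L′ → sumOver F x (L List.++ L′) ≈ sumOver F x L + sumOver F x L′
  sumOver-++ F x []      L′ = ≈-sym (+-identityˡ _)
  sumOver-++ F x (α ∷ L) L′ = ≈-trans (+-congˡ (sumOver-++ F x L L′)) (≈-sym (+-assoc _ _ _))

  sumOver-concatMap : ∀ {k} (F : Series k) x (h : ℕ → List (Vec ℕ k)) g n →
    sumOver F x (List.concatMap h (List.applyUpTo g n)) ≈ sum {n} (λ i → sumOver F x (h (g (toℕ i))))
  sumOver-concatMap F x h g zero    = ≈-refl
  sumOver-concatMap F x h g (suc n) = ≈-trans (sumOver-++ F x (h (g 0)) _)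
    (+-congˡ (sumOver-concatMap F x h (g ∘ suc) n))

  sumOver-map : ∀ {k} (F : Series (suc k)) x y i L →
    sumOver F (x ∷ y) (List.map (i ∷_) L) ≈ x ^ i * sumOver (slice F i) y L
  sumOver-map F x y i []      = ≈-sym (zeroʳ _)
  sumOver-map F x y i (α ∷ L) = ≈-trans (+-congˡ (sumOver-map F x y i L))
    (solve 4 (λ a w m s → a :* (w :* m) :+ w :* s := w :* (a :* m :+ s)) ≈-refl
      (F (i ∷ α)) (x ^ i) (monomial y α) (sumOver (slice F i) y L))

  -- The enumeration of exponents enters through its two recursion equations alone: they match the
  -- recursion of `truncation` on the variables.
  module _ (exponents : ∀ k → ℕ → List (Vec ℕ k))
           (exponents-zero : ∀ n → exponents 0 n ≡ [] ∷ [])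
           (exponents-suc : ∀ k n → exponents (suc k) n ≡
             List.concatMap (λ i → List.map (i ∷_) (exponents k (n ∸ i))) (List.upTo (suc n))) where

    sumOver-exponents : ∀ {k} (F : Series k) x n → sumOver F x (exponents k n) ≈ truncation F x n
    sumOver-exponents F [] n rewrite exponents-zero n =
      solve 1 (λ a → a :* con (+ 1) :+ con (+ 0) := a) ≈-refl (F [])
    sumOver-exponents {suc k} F (x ∷ y) n rewrite exponents-suc k n = ≈-trans
      (sumOver-concatMap F (x ∷ y) (λ i → List.map (i ∷_) (exponents k (n ∸ i))) (λ i → i) (suc n))
      (sum-cong-≋ {suc n} λ i → ≈-trans (sumOver-map F x y (toℕ i) (exponents k (n ∸ toℕ i)))
        (*-congˡ (sumOver-exponents (slice F (toℕ i)) y (n ∸ toℕ i))))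

  levelAnalytic : ∀ m (f : Carrier → Carrier) → (∀ {x y} → x ≈ y → f x ≈ f y) →
    (shift : Carrier → Carrier → Carrier) → (∀ a u → shift a u ≈ a + π ^ m * u) →
    (∀ a → Analytic (λ u → f (shift a u))) → LevelAnalytic m f
  levelAnalytic m f f-cong shift shift≈ f-analytic a =
    analytic-cong (λ u → f-cong (≈-sym (shift≈ a u))) (f-analytic a)

  -- The predicates and maps that occur in the conclusion are parameters, so that the theorem can be
  -- stated with notions that agree with the ones above only up to provable equivalence.
  module _ (Restricted′  : ∀ {k} → Series k → Set)
           (restricted⇒  : ∀ {k} (F : Series k) → Restricted′ F → Restricted F)
           (restricted⇐  : ∀ {k} (F : Series k) → Restricted F → Restricted′ F)
           (Value′       : ∀ {k} → Series k → Vec Carrier k → Carrier → Set)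
           (value⇒       : ∀ {k} (F : Series k) x y → Value′ F x y → F ⟦ x ⟧⟶ y)
           (value⇐       : ∀ {k} (F : Series k) x y → F ⟦ x ⟧⟶ y → Value′ F x y) where

    jet-expansion : ∀ m (f : Carrier → Carrier) → (∀ {x y} → x ≈ y → f x ≈ f y) →
      (jet′ : Carrier → Vec Carrier (suc m)) → (∀ a → jet′ a ≡ jet m a) →
      LevelAnalytic m f →
      ∃! (λ F G → ∀ α → F α ≈ G α) λ (F : Series (suc m)) →
        Restricted′ F × Reduced F × (∀ a → Value′ F (jet′ a) (f a))
    jet-expansion m f f-cong jet′ jet′≡ f-analytic =
      let (F , F-restricted , F-reduced , F→f) = existence m f f-cong f-analytic
      in F ,
         (restricted⇐ F F-restricted , F-reduced , λ a →
           subst (λ x → Value′ F x (f a)) (≡.sym (jet′≡ a)) (value⇐ F (jet m a) (f a) (F→f a))) ,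
         λ {G} (_ , G-reduced , G→f) α → x-y≈0⇒x≈y (uniqueness m (λ α → F α - G α)
           (λ α ¬I → ≈-trans (+-cong (F-reduced α ¬I) (-‿cong (G-reduced α ¬I))) (-‿inverseʳ 0#))
           (λ a → value-difference F G (jet m a) (F→f a)
             (subst (λ x → G ⟦ x ⟧⟶ f a) (jet′≡ a) (value⇒ G (jet′ a) (f a) (G→f a)))) α)

-- The p-adic integers as an instance

module PAdicInstance (q : ℕ) (p-prime : Prime (suc q)) where

  open Cong
  open PAdic (suc q) p-prime
  open Mult semiring using () renaming (_×_ to _·_)

  private
    p = suc q

    P : ℤ
    P = + p

    pᵏ∣ : ∀ k z → P ℤ.^ k ℤ∣.∣ P ℤ.^ k ℤ.* z
    pᵏ∣ k z = ℤ∣.divides z (ℤ.*-comm (P ℤ.^ k) z)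

    1∣ : ∀ z → ℤ.1ℤ ℤ∣.∣ z
    1∣ z = ℤ∣.divides z (≡.sym (ℤ.*-identityʳ z))

    res-· : ∀ k n → res (k · 1#) n ≡ + k
    res-· zero    n = refl
    res-· (suc k) n = cong (λ z → ℤ.1ℤ ℤ.+ z) (res-· k n)

    -- Cancelling p costs one digit, so residue n + 1 is divided and coherence leads back to residue
    -- n.
    cancel : ∀ x → pₚ * x ≈ 0# → x ≈ 0#
    cancel x e = mk≈ λ n → ∣-trans (res x n) (res x (suc n)) ℤ.0ℤ
      (∣-sym (res x (suc n)) (res x n) (coherent x n))
      (ℤ∣.*-cancelˡ-∣ P (subst (P ℤ.^ suc n ℤ∣.∣_) (factor P (res x (suc n))) (res-≈ e (suc n))))
      where
      factor : ∀ a b → a ℤ.* b ℤ.- ℤ.0ℤ ≡ a ℤ.* (b ℤ.- ℤ.0ℤ)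
      factor = solve-∀

    separate : ∀ x → (∀ n → ∃ λ y → x ≈ pₚ ^ n * y) → x ≈ 0#
    separate x h = mk≈ λ n → let (y , e) = h n in
      ∣-trans (res x n) (res (pₚ ^ n * y) n) ℤ.0ℤ (res-≈ e n)
        (subst (P ℤ.^ n ℤ∣.∣_)
          (≡.trans (≡.sym (ℤ.+-identityʳ _)) (cong (λ z → z ℤ.* res y n ℤ.- ℤ.0ℤ) (≡.sym (res-^ pₚ n n))))
          (pᵏ∣ n (res y n)))

    -- The tail is multiplied by p, so one digit less of it suffices; modulo p⁰ any value serves as
    -- a start.
    infRes : (ℕ → ℤₚ) → ℕ → ℤ
    infRes d zero    = ℤ.0ℤ
    infRes d (suc n) = res (d 0) (suc n) ℤ.+ P ℤ.* infRes (d ∘ suc) n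

    ∣-P* : ∀ n a b → P ℤ.^ n ℤ∣.∣ a ℤ.- b → P ℤ.^ suc n ℤ∣.∣ P ℤ.* a ℤ.- P ℤ.* b
    ∣-P* n a b h = subst (P ℤ.^ suc n ℤ∣.∣_) (factor P a b) (ℤ∣.*-monoʳ-∣ P h)
      where
      factor : ∀ p a b → p ℤ.* (a ℤ.- b) ≡ p ℤ.* a ℤ.- p ℤ.* b
      factor = solve-∀

    infRes-coherent : ∀ d n → P ℤ.^ n ℤ∣.∣ infRes d (suc n) ℤ.- infRes d n
    infRes-coherent d zero    = 1∣ _
    infRes-coherent d (suc n) =
      ∣-+ (res (d 0) (suc (suc n))) (res (d 0) (suc n))
          (P ℤ.* infRes (d ∘ suc) (suc n)) (P ℤ.* infRes (d ∘ suc) n)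
          (coherent (d 0) (suc n))
          (∣-P* n (infRes (d ∘ suc) (suc n)) (infRes (d ∘ suc) n) (infRes-coherent (d ∘ suc) n))

    inf : (ℕ → ℤₚ) → ℤₚ
    inf d = mkℤₚ (infRes d) (infRes-coherent d)

    inf-unfold : ∀ d → inf d ≈ d 0 + pₚ * inf (d ∘ suc)
    inf-unfold d = mk≈ λ
      { zero    → 1∣ _
      ; (suc n) → ∣-+ (res (d 0) (suc n)) (res (d 0) (suc n))
          (P ℤ.* infRes (d ∘ suc) n) (P ℤ.* infRes (d ∘ suc) (suc n))
          (∣-refl {a = res (d 0) (suc n)} refl)
          (∣-P* n (infRes (d ∘ suc) n) (infRes (d ∘ suc) (suc n))
            (∣-sym (infRes (d ∘ suc) (suc n)) (infRes (d ∘ suc) n) (infRes-coherent (d ∘ suc) n))) }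

    -- The n-th residue of the quotient is read off from residue n + 1 of `w`, which is why
    -- divisibility is asked only from index 1 on; residue 0 carries no information.
    divide-p : ∀ w → (∀ n → P ℤ∣.∣ res w (suc n)) → ∃ λ y → w ≈ pₚ * y
    divide-p w h = y , mk≈ λ n → ∣-sym (P ℤ.* quot n) (res w n)
      (subst (λ z → P ℤ.^ n ℤ∣.∣ z ℤ.- res w n) (eq n) (coherent w n))
      where
      quot : ℕ → ℤ
      quot n = ℤ∣.quotient (h n)
      eq : ∀ n → res w (suc n) ≡ P ℤ.* quot n
      eq n = ≡.trans (ℤ∣._∣_.equality (h n)) (ℤ.*-comm (quot n) P)
      factor : ∀ p a b → p ℤ.* a ℤ.- p ℤ.* b ≡ p ℤ.* (a ℤ.- b)
      factor = solve-∀
      y : ℤₚ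
      y = mkℤₚ quot λ n → ℤ∣.*-cancelˡ-∣ P (subst (P ℤ.^ suc n ℤ∣.∣_)
        (≡.trans (≡.cong₂ ℤ._-_ (eq (suc n)) (eq n)) (factor P (quot (suc n)) (quot n)))
        (coherent w (suc n)))

    p∣res-res₁ : ∀ x n → P ℤ∣.∣ res x (suc n) ℤ.- res x 1
    p∣res-res₁ x zero    = ∣-refl {a = res x 1} refl
    p∣res-res₁ x (suc n) = ∣-trans (res x (suc (suc n))) (res x (suc n)) (res x 1)
      (ℤ∣.∣-trans (ℤ∣.divides (P ℤ.^ n) (ℤ.*-comm P (P ℤ.^ n))) (coherent x (suc n))) (p∣res-res₁ x n)

    residue : ∀ x → ∃ λ (i : Fin p) → ∃ λ y → x ≈ toℕ i · 1# + pₚ * y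
    residue x = Fin.fromℕ< k<p , y , mk≈ λ n → subst (P ℤ.^ n ℤ∣.∣_)
      (≡.trans (move (res x n) (+ k) (P ℤ.* res y n))
        (cong (λ z → res x n ℤ.- (z ℤ.+ P ℤ.* res y n))
          (≡.sym (≡.trans (res-· _ n) (cong +_ (Fin.toℕ-fromℕ< k<p))))))
      (res-≈ w≈py n)
      where
      k : ℕ
      -- Residue 1 is the first that determines x modulo p, and all later ones agree with it there.
      k = res x 1 ℤ.%ℕ p
      k<p : k < p
      k<p = ℤ/.n%ℕd<d (res x 1) p
      move : ∀ a k b → (a ℤ.- k) ℤ.- b ≡ a ℤ.- (k ℤ.+ b)
      move = solve-∀
      cancelˡ : ∀ k z → (k ℤ.+ z) ℤ.- k ≡ z
      cancelˡ = solve-∀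
      w : ℤₚ
      w = x - fromℤ (+ k)
      p∣res₁-k : P ℤ∣.∣ res x 1 ℤ.- + k
      p∣res₁-k = ℤ∣.divides (res x 1 ℤ./ℕ p) (≡.trans
        (cong (ℤ._- + k) (ℤ/.a≡a%ℕn+[a/ℕn]*n (res x 1) p)) (cancelˡ (+ k) _))
      division : ∃ λ y → w ≈ pₚ * y
      division = divide-p w λ n → ∣-trans (res x (suc n)) (res x 1) (+ k) (p∣res-res₁ x n) p∣res₁-k
      y = proj₁ division
      w≈py = proj₂ division

    inverse-mod-p : ∀ k .{{_ : ℕ.NonZero k}} → k < p → ∃ λ u → ∃ λ v → + k ℤ.* u ≡ ℤ.1ℤ ℤ.+ P ℤ.* v
    inverse-mod-p k k<p with coprime-Bézout (prime⇒coprime p-prime k<p)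
    ... | Bézout.-+ a b eq = + b , + a , (begin
      + k ℤ.* + b             ≡⟨ ℤ.*-comm (+ k) (+ b) ⟩
      + b ℤ.* + k             ≡⟨ ℤ.pos-* b k ⟨
      + (b ℕ.* k)             ≡⟨ cong +_ eq ⟨
      + (1 ℕ.+ a ℕ.* p)       ≡⟨ cong (λ z → ℤ.1ℤ ℤ.+ z) (≡.trans (ℤ.pos-* a p) (ℤ.*-comm (+ a) P)) ⟩
      ℤ.1ℤ ℤ.+ P ℤ.* + a      ∎)
      where open ≡.≡-Reasoning
    ... | Bézout.+- a b eq = ℤ.- + b , ℤ.- + a , (begin
      + k ℤ.* ℤ.- + b                           ≡⟨ split (+ k) (+ b) ⟩
      ℤ.1ℤ ℤ.- (ℤ.1ℤ ℤ.+ + b ℤ.* + k)           ≡⟨ cong (λ z → ℤ.1ℤ ℤ.- (ℤ.1ℤ ℤ.+ z)) (ℤ.pos-* b k) ⟨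
      ℤ.1ℤ ℤ.- + (1 ℕ.+ b ℕ.* k)                ≡⟨ cong (λ z → ℤ.1ℤ ℤ.- + z) eq ⟩
      ℤ.1ℤ ℤ.- + (a ℕ.* p)                      ≡⟨ cong (λ z → ℤ.1ℤ ℤ.- z) (ℤ.pos-* a p) ⟩
      ℤ.1ℤ ℤ.- + a ℤ.* P                        ≡⟨ swap (+ a) P ⟩
      ℤ.1ℤ ℤ.+ P ℤ.* ℤ.- + a                    ∎)
      where
      open ≡.≡-Reasoning
      split : ∀ k b → k ℤ.* ℤ.- b ≡ ℤ.1ℤ ℤ.- (ℤ.1ℤ ℤ.+ b ℤ.* k)
      split = solve-∀
      swap : ∀ a p → ℤ.1ℤ ℤ.- a ℤ.* p ≡ ℤ.1ℤ ℤ.+ p ℤ.* ℤ.- a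
      swap = solve-∀

    +∸ : ∀ {i j} → i ≤ j → + j ≡ + i ℤ.+ + (j ∸ i)
    +∸ {i} {j} i≤j = cong +_ (≡.sym (ℕ.m+[n∸m]≡n i≤j))

    -- Up to sign the difference is a natural number strictly between 0 and p, hence coprime to p.
    difference-inverse : ∀ {i j} → i < p → j < p → i ≢ j →
      ∃ λ u → ∃ λ v → (+ i ℤ.- + j) ℤ.* u ≡ ℤ.1ℤ ℤ.+ P ℤ.* v
    difference-inverse {i} {j} i<p j<p i≢j with ℕ.<-cmp i j
    ... | tri≈ _ i≡j _ = contradiction i≡j i≢j
    ... | tri< i<j _ _ =
      let (u , v , e) = inverse-mod-p (j ∸ i) {{ℕ.>-nonZero (ℕ.m<n⇒0<n∸m i<j)}} (ℕ.≤-<-trans (ℕ.m∸n≤m j i) j<p)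
      in ℤ.- u , v , ≡.trans (cong (λ z → (+ i ℤ.- z) ℤ.* ℤ.- u) (+∸ (ℕ.<⇒≤ i<j)))
           (≡.trans (simplify (+ i) (+ (j ∸ i)) u) e)
      where
      simplify : ∀ i k u → (i ℤ.- (i ℤ.+ k)) ℤ.* ℤ.- u ≡ k ℤ.* u
      simplify = solve-∀
    ... | tri> _ _ j<i =
      let (u , v , e) = inverse-mod-p (i ∸ j) {{ℕ.>-nonZero (ℕ.m<n⇒0<n∸m j<i)}} (ℕ.≤-<-trans (ℕ.m∸n≤m i j) i<p)
      in u , v , ≡.trans (cong (λ z → (z ℤ.- + j) ℤ.* u) (+∸ (ℕ.<⇒≤ j<i)))
           (≡.trans (simplify (+ j) (+ (i ∸ j)) u) e)
      where
      simplify : ∀ j k u → ((j ℤ.+ k) ℤ.- j) ℤ.* u ≡ k ℤ.* u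
      simplify = solve-∀

    distinct : ∀ {i j : Fin p} → i ≢ j →
      ∃ λ u → ∃ λ v → (toℕ i · 1# - toℕ j · 1#) * u ≈ 1# + pₚ * v
    distinct {i} {j} i≢j =
      let (u , v , e) = difference-inverse (Fin.toℕ<n i) (Fin.toℕ<n j) (i≢j ∘ Fin.toℕ-injective)
      in fromℤ u , fromℤ v , mk≈ λ n → ∣-refl (≡.trans
           (≡.cong₂ (λ a b → (a ℤ.- b) ℤ.* u) (res-· (toℕ i) n) (res-· (toℕ j) n)) e)

  -- Rebuilding an equation e as mk≈ (res-≈ e) makes Agda compare the residues of its two sides and
  -- not their coherence proofs, which are out of reach of the conversion checker.
  ℤₚ-adicRing : AdicRing q
  ℤₚ-adicRing = record
    { commutativeRing   = ℤₚ-commutativeRing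
    ; π                 = pₚ
    ; π≈p·1             = mk≈ λ n → ∣-refl (≡.sym (res-· p n))
    ; π-cancel          = λ {x} → cancel x
    ; separated         = λ {x} h → separate x λ n → proj₁ (h n) , mk≈ (res-≈ (proj₂ (h n)))
    ; inf               = inf
    ; inf-unfold        = λ d → mk≈ (res-≈ (inf-unfold d))
    ; δ                 = δ
    ; δ-spec            = λ a → mk≈ (res-≈ (δ-spec a))
    ; residue           = λ x → let (i , y , e) = residue x in i , y , mk≈ (res-≈ e)
    ; residues-distinct = λ i≢j → let (u , v , e) = distinct i≢j in u , v , mk≈ (res-≈ e)
    }

-- Wrapping the statement F(x) = y in a record lets it be compared by its arguments; unfolded, two
-- convertible instances would be compared down to the coherence proofs inside ℤₚ.
record Value {V : ℕ → Set} {W : Set} (P : ∀ {k} → (Vec ℕ k → W) → V k → W → Set)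
             {k : ℕ} (F : Vec ℕ k → W) (x : V k) (y : W) : Set where
  constructor wrap
  field
    unwrap : P F x y

open Value

-- Transfer of the expansion to the p-adic integers

module PAdicExpansion (q : ℕ) (p-prime : Prime (suc q)) where

  open PAdic (suc q) p-prime hiding (δ-jet)
  open Cong
  open Divisibility semiring using (_,_)
  private
    A = PAdicInstance.ℤₚ-adicRing q p-prime
    module A = AdicRing A
    module C = AdicCongruence A
    module N = AnalyticFunctions A
    module I = Interpolation A
    module J = JetExpansion A
    module V = PowerSeriesValues A

  monomial≡ : ∀ {k} (x : Vec ℤₚ k) α → monomial x α ≡ V.monomial x α
  monomial≡ x α = refl

  partialSum≡sumOver : ∀ {k} (F : PowerSeries k) x n → partialSum F x n ≡ V.sumOver F x (exponentsUpTo k n)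
  partialSum≡sumOver {k} F x n = cong (List.foldr _+_ 0#)
    (List.map-cong (λ α → cong (F α *_) (monomial≡ x α)) (exponentsUpTo k n))

  partialSum≈truncation : ∀ {k} (F : PowerSeries k) x n → partialSum F x n A.≈ J.truncation F x n
  partialSum≈truncation F x n = A.≈-trans (A.reflexive (partialSum≡sumOver F x n))
    (V.sumOver-exponents exponentsUpTo (λ _ → refl) (λ _ _ → refl) F x n)

  restricted⇒ : ∀ {k} (F : PowerSeries k) → Restricted F → J.Restricted F
  restricted⇒ F h N = let (M , g) = h N in
    M , λ α b → let (k , e) = g α b in V.congruent-zero (F α) k (mk≈ (res-≈ e))

  restricted⇐ : ∀ {k} (F : PowerSeries k) → J.Restricted F → Restricted F
  restricted⇐ F h N = let (M , g) = h N in
    M , λ α b → C._≈_mod_.quot (g α b) , mk≈ (res-≈ (V.quot-zero (F α) (g α b)))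

  value⇒ : ∀ {k} (F : PowerSeries k) x y → F ⟦ x ⟧≈ y → F J.⟦ x ⟧⟶ y
  value⇒ F x y h N = let (M , g) = h N in M , λ n b → let (k , e) = g n b in
    C.mod-trans (C.mod-sym (C.mod-≈ (partialSum≈truncation F x n)))
      (V.congruent-difference (partialSum F x n) y k (mk≈ (res-≈ e)))

  value⇐ : ∀ {k} (F : PowerSeries k) x y → F J.⟦ x ⟧⟶ y → F ⟦ x ⟧≈ y
  value⇐ F x y h N = let (M , g) = h N in M , λ n b →
    let d = C.mod-trans (C.mod-≈ (partialSum≈truncation F x n)) (g n b)
    in C._≈_mod_.quot d , mk≈ (res-≈ (V.quot-difference (partialSum F x n) y d))

  analytic-of-series : ∀ (y : ℤₚ → ℤₚ) →
    (∃ λ (F : PowerSeries 1) → Restricted F × (∀ u → F ⟦ u ∷ [] ⟧≈ y u)) → N.Analytic y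
  analytic-of-series y (F , F-restricted , F→y) =
    V.restricted⇒analytic F (restricted⇒ F F-restricted) λ u → value⇒ F (u ∷ []) (y u) (F→y u)

  HasValue : ∀ {k} → PowerSeries k → Vec ℤₚ k → ℤₚ → Set
  HasValue = Value {Vec ℤₚ} _⟦_⟧≈_

  module _ (m : ℕ) (f : Func ℤₚ-setoid ℤₚ-setoid) where

    levelAnalytic : AnalyticOfLevel m f → I.LevelAnalytic m (Func.to f)
    levelAnalytic f-analytic = V.levelAnalytic m (Func.to f) (Func.cong f) (λ a u → a + pₚ ^ m * u)
      (λ a u → mk≈ λ n → ∣-refl {a = res (a + pₚ ^ m * u) n} refl)
      (λ a → analytic-of-series (λ u → Func.to f (a + pₚ ^ m * u)) (f-analytic a))

    unwrap-jet : (F : PowerSeries (suc m)) → (∀ a → HasValue F (PAdic.δ-jet (suc q) p-prime m a) (Func.to f a)) →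
      ∀ a → F ⟦ PAdic.δ-jet (suc q) p-prime m a ⟧≈ Func.to f a
    unwrap-jet F v a = unwrap (v a)

    wrap-jet : (F : PowerSeries (suc m)) → (∀ a → F ⟦ PAdic.δ-jet (suc q) p-prime m a ⟧≈ Func.to f a) →
      ∀ a → HasValue F (PAdic.δ-jet (suc q) p-prime m a) (Func.to f a)
    wrap-jet F v a = wrap (v a)

    WrappedExpansion : Set
    WrappedExpansion = ∃! _≋_ λ (F : PowerSeries (suc m)) →
      Restricted F × SupportedOnI′ F × (∀ a → HasValue F (PAdic.δ-jet (suc q) p-prime m a) (Func.to f a))

    wrapped-expansion : I.LevelAnalytic m (Func.to f) → WrappedExpansion
    wrapped-expansion = V.jet-expansion Restricted restricted⇒ restricted⇐
      HasValue (λ F x y v → value⇒ F x y (unwrap v)) (λ F x y v → wrap (value⇐ F x y v))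
      m (Func.to f) (Func.cong f) (PAdic.δ-jet (suc q) p-prime m) (λ a → refl)

    unwrap-expansion : WrappedExpansion → ∃! _≋_ λ (F : PowerSeries (suc m)) →
      Restricted F × SupportedOnI′ F × (∀ a → F ⟦ PAdic.δ-jet (suc q) p-prime m a ⟧≈ Func.to f a)
    unwrap-expansion (F , (F-restricted , F-supported , F→f) , F-unique) =
      F , (F-restricted , F-supported , unwrap-jet F F→f) ,
      λ {G} e → F-unique {G} (proj₁ e , proj₁ (proj₂ e) , wrap-jet G (proj₂ (proj₂ e)))

-- The copy of δ-jet made by opening PAdic would have to be unfolded to be compared with the one
-- above, so it is written with its qualified name.
theorem5p1 : (p : ℕ) (p-prime : Prime p) (let open PAdic p p-prime) (m : ℕ) (f : Func ℤₚ-setoid ℤₚ-setoid) →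
    AnalyticOfLevel m f →
    ∃! _≋_ λ (F : PowerSeries (suc m)) →
    Restricted F × SupportedOnI′ F × (∀ a → F ⟦ PAdic.δ-jet p p-prime m a ⟧≈ Func.to f a)
theorem5p1 zero    p-prime = contradiction p-prime ¬prime[0]
theorem5p1 (suc q) p-prime m f f-analytic =
  PAdicExpansion.unwrap-expansion q p-prime m f
    (PAdicExpansion.wrapped-expansion q p-prime m f
      (PAdicExpansion.levelAnalytic q p-prime m f f-analytic))
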